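{- For all positive integers $r$, $k$ and $\ell$ with $1\leq \ell< k/r$, we have \[\operatorname{ind}_r(k,\ell)\leq \operatorname{ind}_{\leq r}(k,\ell)\leq \frac{k}{k-r\ell}\cdot \frac{1}{e}.\]
   Context: A hypergraph has a finite vertex set and a set of edges, each edge being a non-empty subset of the vertex set. For a hypergraph $G$ with at least $k$ vertices, let $I(G,k,\ell)$ be the probability that a uniformly random $k$-vertex subset of $V(G)$ contains (as subsets) exactly $\ell$ edges of $G$. For $r\geq 1$, $0\le \ell\le\binom{k}{r}$ and $n\geq k$, let $I_r(n,k,\ell)$ be the maximum of $I(G,k,\ell)$ over all $r$-uniform hypergraphs $G$ on $n$ vertices, and $I_{\leq r}(n,k,\ell)$ the maximum of $I(G,k,\ell)$ over all hypergraphs $G$ on $n$ vertices all of whose edges have size at most $r$. Both are non-increasing in $n$; define $\operatorname{ind}_r(k,\ell)=\lim_{n\to\infty}I_r(n,k,\ell)$ and $\operatorname{ind}_{\leq r}(k,\ell)=\lim_{n\to\infty}I_{\leq r}(n,k,\ell)$. -}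

module Defs where

open import Data.Bool using (Bool; true; false; _∧_; if_then_else_)
open import Data.Nat as ℕ using (ℕ; zero; suc; _≤_; _<_; _∸_; _!)
open import Data.Integer using (+_)
open import Data.Rational as ℚ using (ℚ; 0ℚ)
open import Data.Vec using (Vec; []; _∷_)
open import Data.List using (List; []; _∷_; map; _++_; filter; filterᵇ; length)
open import Data.Fin.Subset using (Subset; ∣_∣; _⊆_)
open import Data.Product using (Σ; _×_; ∃; ∃-syntax)
open import Relation.Binary.PropositionalEquality using (_≡_)
open import Relation.Nullary using (Dec; yes; no)

Hypergraph : ℕ → Set
Hypergraph n = Subset n → Bool

EdgesAtMost : (r : ℕ) {n : ℕ} → Hypergraph n → Set
EdgesAtMost r {n} G = (e : Subset n) → G e ≡ true → (1 ≤ ∣ e ∣) × (∣ e ∣ ≤ r)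

Uniform : (r : ℕ) {n : ℕ} → Hypergraph n → Set
Uniform r {n} G = (e : Subset n) → G e ≡ true → (1 ≤ ∣ e ∣) × (∣ e ∣ ≡ r)

allSubsets : (n : ℕ) → List (Subset n)
allSubsets zero = [] ∷ []
allSubsets (suc n) = map (true ∷_) (allSubsets n) ++ map (false ∷_) (allSubsets n)

subsetᵇ : {n : ℕ} → Subset n → Subset n → Bool
subsetᵇ [] [] = true
subsetᵇ (true ∷ xs) (false ∷ ys) = false
subsetᵇ (_ ∷ xs) (_ ∷ ys) = subsetᵇ xs ys

edgesIn : {n : ℕ} → Hypergraph n → Subset n → ℕ
edgesIn {n} G S = length (filterᵇ (λ e → G e ∧ subsetᵇ e S) (allSubsets n))

kSubsets : (n k : ℕ) → List (Subset n)
kSubsets n k = filter (λ S → ∣ S ∣ ℕ.≟ k) (allSubsets n)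

-- a / d as a rational, with the convention a / 0 = 0 (never used when n ≥ k)
frac : ℕ → ℕ → ℚ
frac a zero = 0ℚ
frac a (suc d) = (+ a) ℚ./ suc d

I : {n : ℕ} → Hypergraph n → (k ℓ : ℕ) → ℚ
I {n} G k ℓ =
  frac (length (filter (λ S → edgesIn G S ℕ.≟ ℓ) (kSubsets n k)))
       (length (kSubsets n k))

IsMaxUniform : (r n k ℓ : ℕ) → ℚ → Set
IsMaxUniform r n k ℓ m =
  (Σ (Hypergraph n) λ G → Uniform r G × (I G k ℓ ≡ m))
  × ((G : Hypergraph n) → Uniform r G → I G k ℓ ℚ.≤ m)

IsMaxAtMost : (r n k ℓ : ℕ) → ℚ → Set
IsMaxAtMost r n k ℓ m =
  (Σ (Hypergraph n) λ G → EdgesAtMost r G × (I G k ℓ ≡ m))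
  × ((G : Hypergraph n) → EdgesAtMost r G → I G k ℓ ℚ.≤ m)

expPartial : ℕ → ℚ
expPartial zero = frac 1 (0 !)
expPartial (suc m) = expPartial m ℚ.+ frac 1 (suc m !)

-- q > k / ((k - rℓ) e), expressed without reals: since the partial sums
-- increase strictly to e and k - rℓ > 0, this holds iff
-- k < q (k - rℓ) s_m for some m.
AboveBound : (r k ℓ : ℕ) → ℚ → Set
AboveBound r k ℓ q =
  ∃[ m ] (frac k 1 ℚ.< q ℚ.* frac (k ∸ r ℕ.* ℓ) 1 ℚ.* expPartial m)

{-# OPTIONS --safe #-}

-- Write e(S) for the number of edges inside S, and let v₁, …, vₖ be a uniformly random
-- sequence of distinct vertices. A k-set with exactly ℓ edges has at least k − rℓ vertices
-- lying in none of them, so it suffices to bound the probability of the event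
-- e(v₁, …, vₖ₋₁) = e(v₁, …, vₖ) = ℓ by about 1/e. If vₜ (t < k) is the vertex that brings
-- the count to ℓ, move it to the end: the remaining k − 1 vertices w span fewer than ℓ
-- edges, and vₜ is one of the Q(w₁, …, wₜ₋₁) vertices completing at least ℓ edges with
-- w₁, …, wₜ₋₁. So the probability is about E[1{e(w) < ℓ} · Σₜ Q(w₁, …, wₜ₋₁) / n]. At each
-- step w avoids the completing vertices with probability about 1 − Q/n, so by AM-GM the
-- expectation is at most (1 − 1/k)ᵏ, and (1 − 1/k)ᵏ ≤ 1/e.
module Submission where

open import Defs
open import Data.Bool using (true; false; _∧_)
open import Data.Bool.Properties using (T-≡; ∧-conicalˡ; ∧-conicalʳ) renaming (_≟_ to _≟ᵇ_)
open import Data.Empty using (⊥-elim)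
open import Data.Fin using (Fin; zero; suc)
open import Data.Fin.Properties using () renaming (_≟_ to _≟ᶠ_)
open import Data.Fin.Subset using (Subset; ∣_∣; ⊥)
open import Data.Fin.Subset.Properties using (∣⊥∣≡0)
open import Data.List using (List; []; _∷_; _++_; map; filter; length; allFin)
open import Data.List.Properties using (map-tabulate)
open import Data.Nat using (ℕ; zero; suc; _≤_; _<_; _*_; _∸_; _^_; z≤n; NonZero; >-nonZero; _!; _≟_; _<?_)
open import Data.Nat.Properties hiding (_≟_; _<?_)
open import Data.Nat.Tactic.RingSolver using (solve-∀)
open import Data.Product using (_×_; _,_; proj₁; proj₂; ∃-syntax; Σ-syntax)
open import Data.Vec using ([]; _∷_; lookup; _[_]≔_)
open import Data.Vec.Properties using (lookup∘update; lookup∘update′; []≔-commutes; lookup-replicate)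
open import Function using (_∘_; id)
open import Function.Bundles using (Equivalence)
open import Relation.Binary.PropositionalEquality using (_≡_; _≢_; refl; sym; trans; cong; cong₂; subst; subst₂)
open import Relation.Nullary using (Dec; yes; no; ¬_)
open import Relation.Nullary.Decidable using (¬?; T?)

-- AM-GM, the estimate (1 - 1/k)^k ≤ 1/e, and powers of n - k against powers of n.

module Inequalities where

  open import Data.Nat using (_+_)
  open ≤-Reasoning

  ^-distribʳ-* : ∀ a b j → (a * b) ^ j ≡ a ^ j * b ^ j
  ^-distribʳ-* a b zero = refl
  ^-distribʳ-* a b (suc j) = trans (cong (a * b *_) (^-distribʳ-* a b j)) (shuffle a b (a ^ j) (b ^ j))
    where
    shuffle : ∀ a b c d → a * b * (c * d) ≡ a * c * (b * d)
    shuffle = solve-∀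

  2xy≤x²+y² : ∀ x y → 2 * (x * y) ≤ x * x + y * y
  2xy≤x²+y² zero    y       = z≤n
  2xy≤x²+y² (suc x) zero    = ≤-trans (≤-reflexive (cong (2 *_) (*-zeroʳ x))) z≤n
  2xy≤x²+y² (suc x) (suc y) = begin
    2 * (suc x * suc y)                      ≡⟨ lhs x y ⟩
    2 * (x * y) + 2 * (x + y + 1)            ≤⟨ +-monoˡ-≤ (2 * (x + y + 1)) (2xy≤x²+y² x y) ⟩
    x * x + y * y + 2 * (x + y + 1)          ≡⟨ rhs x y ⟩
    suc x * suc x + suc y * suc y            ∎
    where
    lhs : ∀ x y → 2 * (suc x * suc y) ≡ 2 * (x * y) + 2 * (x + y + 1)
    lhs = solve-∀
    rhs : ∀ x y → x * x + y * y + 2 * (x + y + 1) ≡ suc x * suc x + suc y * suc y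
    rhs = solve-∀

  -- AM-GM for `x ^ suc j` and `j` copies of `y ^ suc j`; this homogeneous form of Bernoulli's
  -- inequality avoids subtraction and division.
  bernoulli : ∀ x y j → suc j * (x * y ^ j) ≤ x ^ suc j + j * y ^ suc j
  bernoulli x y zero    = ≤-reflexive (base x)
    where
    base : ∀ x → 1 * (x * 1) ≡ x * 1 + 0
    base = solve-∀
  -- `x` times the inductive hypothesis and `suc j * y ^ j` times `2xy≤x²+y²` combine to the claim
  -- with `j * (x * (y * p))` added on both sides.
  bernoulli x y (suc j) = +-cancelʳ-≤ (j * (x * (y * p))) _ _ (begin
    suc (suc j) * (x * (y * p)) + j * (x * (y * p))      ≡⟨ e₁ x y p j ⟩
    suc j * p * (2 * (x * y))                            ≤⟨ *-monoʳ-≤ (suc j * p) (2xy≤x²+y² x y) ⟩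
    suc j * p * (x * x + y * y)                          ≡⟨ e₂ x y p j ⟩
    x * (suc j * (x * p)) + suc j * (y * (y * p))        ≤⟨ +-monoˡ-≤ (suc j * (y * (y * p))) (*-monoʳ-≤ x (bernoulli x y j)) ⟩
    x * (x ^ suc j + j * (y * p)) + suc j * (y * (y * p)) ≡⟨ e₃ x y p j (x ^ suc j) ⟩
    x * x ^ suc j + suc j * (y * (y * p)) + j * (x * (y * p)) ∎)
    where
    p = y ^ j
    e₁ : ∀ x y p j → suc (suc j) * (x * (y * p)) + j * (x * (y * p)) ≡ suc j * p * (2 * (x * y))
    e₁ = solve-∀
    e₂ : ∀ x y p j → suc j * p * (x * x + y * y) ≡ x * (suc j * (x * p)) + suc j * (y * (y * p))
    e₂ = solve-∀
    e₃ : ∀ x y p j q → x * (q + j * (y * p)) + suc j * (y * (y * p)) ≡ x * q + suc j * (y * (y * p)) + j * (x * (y * p))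
    e₃ = solve-∀

  -- AM-GM for one copy of a and j copies of c / j, which is Bernoulli's
  -- inequality at x = j (a + c) and y = (j + 1) c.
  weighted-am-gm : ∀ a c j .{{_ : NonZero j}} →
    suc j ^ suc j * (a * c ^ j) ≤ j ^ j * (a + c) ^ suc j
  weighted-am-gm a c j = *-cancelˡ-≤ j (begin
    j * (suc j ^ suc j * (a * c ^ j))         ≡⟨ e₁ j (suc j ^ j) a (c ^ j) ⟩
    j * suc j * a * (suc j ^ j * c ^ j)       ≡⟨ cong (j * suc j * a *_) (^-distribʳ-* (suc j) c j) ⟨
    j * suc j * a * y ^ j                     ≤⟨ +-cancelʳ-≤ (j * y ^ suc j) _ _ step ⟩
    x ^ suc j                                 ≡⟨ ^-distribʳ-* j (a + c) (suc j) ⟩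
    j * j ^ j * (a + c) ^ suc j               ≡⟨ *-assoc j (j ^ j) _ ⟩
    j * (j ^ j * (a + c) ^ suc j)             ∎)
    where
    x = j * (a + c)
    y = suc j * c
    e₁ : ∀ j s a p → j * (suc j * s * (a * p)) ≡ j * suc j * a * (s * p)
    e₁ = solve-∀
    e₂ : ∀ j a c q → j * suc j * a * q + j * (suc j * c * q) ≡ suc j * (j * (a + c) * q)
    e₂ = solve-∀
    step : j * suc j * a * y ^ j + j * y ^ suc j ≤ x ^ suc j + j * y ^ suc j
    step = begin
      j * suc j * a * y ^ j + j * y ^ suc j    ≡⟨ e₂ j a c (y ^ j) ⟩
      suc j * (x * y ^ j)                      ≤⟨ bernoulli x y j ⟩
      x ^ suc j + j * y ^ suc j                ∎

  -- The coefficient of y ^ i in (1 - y) ^ (- j).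
  multichoose : ℕ → ℕ → ℕ
  multichoose _       zero    = 1
  multichoose zero    (suc i) = 0
  multichoose (suc j) (suc i) = multichoose j (suc i) + multichoose (suc j) i

  -- `multichoose j i` is the binomial coefficient of j + i - 1 over i, and this is the ratio of two
  -- consecutive ones.
  multichoose-absorb : ∀ j i → suc i * multichoose j (suc i) ≡ (j + i) * multichoose j i
  multichoose-absorb zero    zero    = refl
  multichoose-absorb zero    (suc i) = trans (*-zeroʳ (suc (suc i))) (sym (*-zeroʳ (suc i)))
  multichoose-absorb (suc j) zero    = trans (cong (λ z → 1 * (z + 1)) (trans (sym (*-identityˡ _)) (multichoose-absorb j zero))) (e j)
    where
    e : ∀ j → 1 * ((j + 0) * 1 + 1) ≡ (suc j + 0) * 1
    e = solve-∀
  multichoose-absorb (suc j) (suc i) =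
    trans (e₁ i (multichoose j (suc (suc i))) (c + d))
      (trans (cong₂ (λ u v → u + v + (c + d)) (multichoose-absorb j (suc i)) (multichoose-absorb (suc j) i))
        (e₂ i j c d))
    where
    c = multichoose j (suc i)
    d = multichoose (suc j) i
    e₁ : ∀ i a b → suc (suc i) * (a + b) ≡ suc (suc i) * a + suc i * b + b
    e₁ = solve-∀
    e₂ : ∀ i j c d → (j + suc i) * c + (suc j + i) * d + (c + d) ≡ (suc j + suc i) * (c + d)
    e₂ = solve-∀

  -- By `multichoose-absorb`, `i ! * multichoose j i` is the rising factorial j (j + 1) ⋯ (j + i -
  -- 1), none of whose factors is below j.
  ^≤!*multichoose : ∀ j i → j ^ i ≤ i ! * multichoose j i
  ^≤!*multichoose j zero    = ≤-refl
  ^≤!*multichoose j (suc i) = begin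
    j * j ^ i                            ≤⟨ *-mono-≤ (m≤m+n j i) (^≤!*multichoose j i) ⟩
    (j + i) * (i ! * multichoose j i)    ≡⟨ e₁ (j + i) (i !) _ ⟩
    i ! * ((j + i) * multichoose j i)    ≡⟨ cong (i ! *_) (multichoose-absorb j i) ⟨
    i ! * (suc i * multichoose j (suc i)) ≡⟨ e₂ (i !) (suc i) _ ⟩
    suc i ! * multichoose j (suc i)      ∎
    where
    e₁ : ∀ a b c → a * (b * c) ≡ b * (a * c)
    e₁ = solve-∀
    e₂ : ∀ a b c → a * (b * c) ≡ b * a * c
    e₂ = solve-∀

  -- k ^ m times the degree-m truncation of (1 - y) ^ (- j) at y = 1 / k.
  truncated : ℕ → ℕ → ℕ → ℕ
  truncated k j zero    = 1
  truncated k j (suc m) = k * truncated k j m + multichoose j (suc m)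

  truncated-zero : ∀ k m → truncated k 0 m ≡ k ^ m
  truncated-zero k zero    = refl
  truncated-zero k (suc m) = trans (+-identityʳ _) (cong (k *_) (truncated-zero k m))

  truncated-pascal : ∀ k j m → truncated k (suc j) (suc m) ≡ truncated k j (suc m) + truncated k (suc j) m
  truncated-pascal k j zero    = sym (+-assoc (k * 1) (multichoose j 1) 1)
  truncated-pascal k j (suc m) =
    trans (cong (λ z → k * z + (multichoose j (suc (suc m)) + multichoose (suc j) (suc m))) (truncated-pascal k j m))
      (e k (truncated k j (suc m)) (truncated k (suc j) m) (multichoose j (suc (suc m))) (multichoose (suc j) (suc m)))
    where
    e : ∀ k a b c d → k * (a + b) + (c + d) ≡ k * a + c + (k * b + d)
    e = solve-∀

  -- Let y = 1/(k + 1). Multiplying the series of (1 - y)^-(j + 1) by 1 - y gives that of (1 -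
  -- y)^-j; for the truncations the product has one further term, of degree m + 1, and it is
  -- negative.
  truncated-step : ∀ k j m → k * truncated (suc k) (suc j) m ≤ suc k * truncated (suc k) j m
  truncated-step k j zero    = *-monoˡ-≤ 1 (n≤1+n k)
  truncated-step k j (suc m) = +-cancelʳ-≤ t _ _ (begin
    k * t + t                                           ≡⟨ +-comm (k * t) t ⟩
    suc k * t                                           ≡⟨ cong (suc k *_) (truncated-pascal (suc k) j m) ⟩
    suc k * (s + truncated (suc k) (suc j) m)           ≡⟨ *-distribˡ-+ (suc k) s _ ⟩
    suc k * s + suc k * truncated (suc k) (suc j) m     ≤⟨ +-monoʳ-≤ (suc k * s) (m≤m+n _ (multichoose (suc j) (suc m))) ⟩
    suc k * s + t                                       ∎)
    where
    t = truncated (suc k) (suc j) (suc m)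
    s = truncated (suc k) j (suc m)

  -- Applied j times, `truncated-step` bounds the truncation of (1 - y)^-j by the full value ((k +
  -- 1)/k)^j.
  truncated-iterate : ∀ k j m → k ^ j * truncated (suc k) j m ≤ suc k ^ j * suc k ^ m
  truncated-iterate k zero    m = *-monoʳ-≤ 1 (≤-reflexive (truncated-zero (suc k) m))
  truncated-iterate k (suc j) m = begin
    k * k ^ j * truncated (suc k) (suc j) m        ≡⟨ e k (k ^ j) _ ⟩
    k ^ j * (k * truncated (suc k) (suc j) m)      ≤⟨ *-monoʳ-≤ (k ^ j) (truncated-step k j m) ⟩
    k ^ j * (suc k * truncated (suc k) j m)        ≡⟨ e′ (k ^ j) (suc k) _ ⟩
    suc k * (k ^ j * truncated (suc k) j m)        ≤⟨ *-monoʳ-≤ (suc k) (truncated-iterate k j m) ⟩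
    suc k * (suc k ^ j * suc k ^ m)                ≡⟨ *-assoc (suc k) (suc k ^ j) _ ⟨
    suc k * suc k ^ j * suc k ^ m                  ∎
    where
    e : ∀ a b c → a * b * c ≡ b * (a * c)
    e = solve-∀
    e′ : ∀ a b c → a * (b * c) ≡ b * (a * c)
    e′ = solve-∀

  -- m ! times the m-th partial sum of e.
  expNumerator : ℕ → ℕ
  expNumerator zero    = 1
  expNumerator (suc m) = suc m * expNumerator m + 1

  -- Term by term: for positive k, `^≤!*multichoose` says that 1/i! is at most `multichoose k i` /
  -- k^i, so the m-th partial sum of e is at most the truncation of (1 - 1/k)^-k.
  expNumerator≤truncated : ∀ k m → k ^ m * expNumerator m ≤ m ! * truncated k k m
  expNumerator≤truncated k zero    = ≤-refl
  expNumerator≤truncated k (suc m) = begin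
    k * k ^ m * (suc m * expNumerator m + 1)                  ≡⟨ e₁ k (k ^ m) (suc m) (expNumerator m) ⟩
    suc m * k * (k ^ m * expNumerator m) + k ^ suc m          ≤⟨ +-mono-≤ (*-monoʳ-≤ (suc m * k) (expNumerator≤truncated k m)) (^≤!*multichoose k (suc m)) ⟩
    suc m * k * (m ! * truncated k k m) + suc m ! * multichoose k (suc m) ≡⟨ e₂ (suc m) k (m !) (truncated k k m) (multichoose k (suc m)) ⟩
    suc m ! * (k * truncated k k m + multichoose k (suc m))   ∎
    where
    e₁ : ∀ k p s x → k * p * (s * x + 1) ≡ s * k * (p * x) + k * p
    e₁ = solve-∀
    e₂ : ∀ s k f t c → s * k * (f * t) + s * f * c ≡ s * f * (k * t + c)
    e₂ = solve-∀

  -- (1 - 1 / (k + 1)) ^ (k + 1) ≤ 1 / e.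
  expNumerator-bound : ∀ k m → expNumerator m * k ^ suc k ≤ m ! * suc k ^ suc k
  expNumerator-bound k m = *-cancelˡ-≤ (suc k ^ m) {{m^n≢0 (suc k) m}} (begin
    suc k ^ m * (expNumerator m * k ^ suc k)          ≡⟨ *-assoc (suc k ^ m) _ _ ⟨
    suc k ^ m * expNumerator m * k ^ suc k            ≤⟨ *-monoˡ-≤ (k ^ suc k) (expNumerator≤truncated (suc k) m) ⟩
    m ! * truncated (suc k) (suc k) m * k ^ suc k     ≡⟨ e₁ (m !) _ (k ^ suc k) ⟩
    m ! * (k ^ suc k * truncated (suc k) (suc k) m)   ≤⟨ *-monoʳ-≤ (m !) (truncated-iterate k (suc k) m) ⟩
    m ! * (suc k ^ suc k * suc k ^ m)                 ≡⟨ e₂ (m !) (suc k ^ suc k) (suc k ^ m) ⟩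
    suc k ^ m * (m ! * suc k ^ suc k)                 ∎)
    where
    e₁ : ∀ a b c → a * b * c ≡ a * (c * b)
    e₁ = solve-∀
    e₂ : ∀ a b c → a * (b * c) ≡ c * (a * b)
    e₂ = solve-∀

  -- (1 - k / n) ^ j ≥ 1 - k j / n for n = d + k.
  ^-shift-bernoulli : ∀ d k j → (d + k) ^ suc j ≤ (d + k) * d ^ j + k * j * (d + k) ^ j
  ^-shift-bernoulli d k zero    = m≤m+n _ _
  ^-shift-bernoulli d k (suc j) = begin
    n * n ^ suc j                                     ≤⟨ *-monoʳ-≤ n (^-shift-bernoulli d k j) ⟩
    n * (n * d ^ j + k * j * n ^ j)                   ≡⟨ e₁ d k j (d ^ j) (n ^ j) ⟩
    n * (d * d ^ j) + k * j * (n * n ^ j) + k * (n * d ^ j)   ≤⟨ +-monoʳ-≤ (n * (d * d ^ j) + k * j * (n * n ^ j)) (*-monoʳ-≤ k (*-monoʳ-≤ n (^-monoˡ-≤ j (m≤m+n d k)))) ⟩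
    n * (d * d ^ j) + k * j * (n * n ^ j) + k * (n * n ^ j)   ≡⟨ e₂ k j (n * (d * d ^ j)) (n * n ^ j) ⟩
    n * (d * d ^ j) + k * suc j * (n * n ^ j)         ∎
    where
    n = d + k
    e₁ : ∀ d k j p q → (d + k) * ((d + k) * p + k * j * q) ≡ (d + k) * (d * p) + k * j * ((d + k) * q) + k * ((d + k) * p)
    e₁ = solve-∀
    e₂ : ∀ k j a b → a + k * j * b + k * b ≡ a + k * suc j * b
    e₂ = solve-∀

  -- For n ≥ (x + 1) k² the preceding bound with j = k gives (1 - k/n)^k ≥ 1 - k²/n ≥ x/(x + 1).
  -- This pays for replacing the number of k-sets by n^k / k!.
  ^-shift-≤ : ∀ x k n .{{_ : NonZero n}} → k ≤ n → suc x * (k * k) ≤ n →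
    x * n ^ k ≤ suc x * (n ∸ k) ^ k
  ^-shift-≤ x k n k≤n big = *-cancelˡ-≤ n (+-cancelʳ-≤ (n * n ^ k) _ _ (begin
    n * (x * n ^ k) + n * n ^ k                         ≡⟨ e₁ n x (n ^ k) ⟩
    suc x * (n * n ^ k)                                 ≤⟨ *-monoʳ-≤ (suc x) shifted ⟩
    suc x * (n * d ^ k + k * k * n ^ k)                 ≡⟨ e₂ (suc x) n (d ^ k) (k * k) (n ^ k) ⟩
    n * (suc x * d ^ k) + suc x * (k * k) * n ^ k       ≤⟨ +-monoʳ-≤ (n * (suc x * d ^ k)) (*-monoˡ-≤ (n ^ k) big) ⟩
    n * (suc x * d ^ k) + n * n ^ k                     ∎))
    where
    d = n ∸ k
    shifted : n * n ^ k ≤ n * d ^ k + k * k * n ^ k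
    shifted = subst (λ z → z * z ^ k ≤ z * d ^ k + k * k * z ^ k) (m∸n+n≡m k≤n) (^-shift-bernoulli d k k)
    e₁ : ∀ n x p → n * (x * p) + n * p ≡ suc x * (n * p)
    e₁ = solve-∀
    e₂ : ∀ s n d k p → s * (n * d + k * p) ≡ n * (s * d) + s * k * p
    e₂ = solve-∀

-- Indicators and finite sums.

module Sums where

  open import Data.Nat using (_+_)

  𝟙 : {P : Set} → Dec P → ℕ
  𝟙 (yes _) = 1
  𝟙 (no _)  = 0

  𝟙-yes : {P : Set} (d : Dec P) → P → 𝟙 d ≡ 1
  𝟙-yes (yes _) _ = refl
  𝟙-yes (no ¬p) p = ⊥-elim (¬p p)

  𝟙-no : {P : Set} (d : Dec P) → ¬ P → 𝟙 d ≡ 0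
  𝟙-no (yes p) ¬p = ⊥-elim (¬p p)
  𝟙-no (no _)  _  = refl

  𝟙≤1 : {P : Set} (d : Dec P) → 𝟙 d ≤ 1
  𝟙≤1 (yes _) = ≤-refl
  𝟙≤1 (no _)  = z≤n

  𝟙-≤ : {P : Set} (d : Dec P) {x y : ℕ} → (P → x ≤ y) → 𝟙 d * x ≤ y
  𝟙-≤ (yes p) h = ≤-trans (≤-reflexive (+-identityʳ _)) (h p)
  𝟙-≤ (no _)  h = z≤n

  𝟙-*-mono : {P : Set} (d : Dec P) {x y : ℕ} → (P → x ≤ y) → 𝟙 d * x ≤ 𝟙 d * y
  𝟙-*-mono (yes p) h = *-monoʳ-≤ 1 (h p)
  𝟙-*-mono (no _)  h = z≤n

  𝟙-mono : {P Q : Set} (d : Dec P) (d′ : Dec Q) → (P → Q) → 𝟙 d ≤ 𝟙 d′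
  𝟙-mono (yes p) d′ f = ≤-reflexive (sym (𝟙-yes d′ (f p)))
  𝟙-mono (no _)  d′ f = z≤n

  𝟙-cong : {P Q : Set} (d : Dec P) (d′ : Dec Q) → (P → Q) → (Q → P) → 𝟙 d ≡ 𝟙 d′
  𝟙-cong d d′ f g = ≤-antisym (𝟙-mono d d′ f) (𝟙-mono d′ d g)

  ∑ : {A : Set} → List A → (A → ℕ) → ℕ
  ∑ []       f = 0
  ∑ (x ∷ xs) f = f x + ∑ xs f

  ∑-cong : {A : Set} (xs : List A) {f g : A → ℕ} → (∀ x → f x ≡ g x) → ∑ xs f ≡ ∑ xs g
  ∑-cong []       h = refl
  ∑-cong (x ∷ xs) h = cong₂ _+_ (h x) (∑-cong xs h)

  ∑-mono : {A : Set} (xs : List A) {f g : A → ℕ} → (∀ x → f x ≤ g x) → ∑ xs f ≤ ∑ xs g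
  ∑-mono []       h = z≤n
  ∑-mono (x ∷ xs) h = +-mono-≤ (h x) (∑-mono xs h)

  ∑-zero : {A : Set} (xs : List A) → ∑ xs (λ _ → 0) ≡ 0
  ∑-zero []       = refl
  ∑-zero (_ ∷ xs) = ∑-zero xs

  ∑-one : {A : Set} (xs : List A) → ∑ xs (λ _ → 1) ≡ length xs
  ∑-one []       = refl
  ∑-one (_ ∷ xs) = cong suc (∑-one xs)

  ∑-distrib-+ : {A : Set} (xs : List A) (f g : A → ℕ) → ∑ xs (λ x → f x + g x) ≡ ∑ xs f + ∑ xs g
  ∑-distrib-+ []       f g = refl
  ∑-distrib-+ (x ∷ xs) f g = trans (cong (f x + g x +_) (∑-distrib-+ xs f g)) (e (f x) (g x) (∑ xs f) (∑ xs g))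
    where
    e : ∀ a b c d → a + b + (c + d) ≡ a + c + (b + d)
    e = solve-∀

  ∑-*ˡ : {A : Set} (xs : List A) (c : ℕ) (f : A → ℕ) → ∑ xs (λ x → c * f x) ≡ c * ∑ xs f
  ∑-*ˡ []       c f = sym (*-zeroʳ c)
  ∑-*ˡ (x ∷ xs) c f = trans (cong (c * f x +_) (∑-*ˡ xs c f)) (sym (*-distribˡ-+ c (f x) (∑ xs f)))

  ∑-*ʳ : {A : Set} (xs : List A) (f : A → ℕ) (c : ℕ) → ∑ xs (λ x → f x * c) ≡ ∑ xs f * c
  ∑-*ʳ xs f c = trans (∑-cong xs (λ x → *-comm (f x) c)) (trans (∑-*ˡ xs c f) (*-comm c (∑ xs f)))

  ∑-swap : {A B : Set} (xs : List A) (ys : List B) (f : A → B → ℕ) →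
    ∑ xs (λ x → ∑ ys (f x)) ≡ ∑ ys (λ y → ∑ xs (λ x → f x y))
  ∑-swap []       ys f = sym (∑-zero ys)
  ∑-swap (x ∷ xs) ys f = trans (cong (∑ ys (f x) +_) (∑-swap xs ys f)) (sym (∑-distrib-+ ys (f x) _))

  ∑-++ : {A : Set} (xs ys : List A) (f : A → ℕ) → ∑ (xs ++ ys) f ≡ ∑ xs f + ∑ ys f
  ∑-++ []       ys f = refl
  ∑-++ (x ∷ xs) ys f = trans (cong (f x +_) (∑-++ xs ys f)) (sym (+-assoc (f x) _ _))

  ∑-map : {A B : Set} (g : A → B) (xs : List A) (f : B → ℕ) → ∑ (map g xs) f ≡ ∑ xs (f ∘ g)
  ∑-map g []       f = refl
  ∑-map g (x ∷ xs) f = cong (f (g x) +_) (∑-map g xs f)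

  ∑-filter : {A : Set} {P : A → Set} (P? : ∀ x → Dec (P x)) (xs : List A) (f : A → ℕ) →
    ∑ (filter P? xs) f ≡ ∑ xs (λ x → 𝟙 (P? x) * f x)
  ∑-filter P? []       f = refl
  ∑-filter P? (x ∷ xs) f with P? x
  ... | yes _ = cong₂ _+_ (sym (+-identityʳ (f x))) (∑-filter P? xs f)
  ... | no _  = ∑-filter P? xs f

  length-filter : {A : Set} {P : A → Set} (P? : ∀ x → Dec (P x)) (xs : List A) →
    length (filter P? xs) ≡ ∑ xs (λ x → 𝟙 (P? x))
  length-filter P? xs = trans (sym (∑-one (filter P? xs)))
    (trans (∑-filter P? xs (λ _ → 1)) (∑-cong xs (λ x → *-identityʳ (𝟙 (P? x)))))

  ∑-allFin-suc : ∀ n (f : Fin (suc n) → ℕ) → ∑ (allFin (suc n)) f ≡ f zero + ∑ (allFin n) (f ∘ suc)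
  ∑-allFin-suc n f = cong (f zero +_)
    (trans (cong (λ xs → ∑ xs f) (sym (map-tabulate id suc))) (∑-map suc (allFin n) f))

  ∑-allFin-one : ∀ n → ∑ (allFin n) (λ _ → 1) ≡ n
  ∑-allFin-one zero    = refl
  ∑-allFin-one (suc n) = trans (∑-allFin-suc n (λ _ → 1)) (cong suc (∑-allFin-one n))

-- Vertex sets and sequences of distinct vertices.

module Subsets where

  open import Data.Nat using (_+_)
  open ≤-Reasoning
  open Sums

  _∈?_ : ∀ {n} (u : Fin n) (S : Subset n) → Dec (lookup S u ≡ true)
  u ∈? S = lookup S u ≟ᵇ true

  _∉?_ : ∀ {n} (u : Fin n) (S : Subset n) → Dec (lookup S u ≡ false)
  u ∉? S = lookup S u ≟ᵇ false

  add : ∀ {n} → Subset n → Fin n → Subset n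
  add S u = S [ u ]≔ true

  remove : ∀ {n} → Subset n → Fin n → Subset n
  remove S u = S [ u ]≔ false

  ∈?+∉? : ∀ {n} (u : Fin n) (S : Subset n) → 𝟙 (u ∈? S) + 𝟙 (u ∉? S) ≡ 1
  ∈?+∉? u S with lookup S u
  ... | true  = refl
  ... | false = refl

  ∑-∈? : ∀ {n} (S : Subset n) → ∑ (allFin n) (λ u → 𝟙 (u ∈? S)) ≡ ∣ S ∣
  ∑-∈? {zero}  []          = refl
  ∑-∈? {suc n} (true ∷ S)  = trans (∑-allFin-suc n (λ u → 𝟙 (u ∈? (true ∷ S)))) (cong suc (∑-∈? S))
  ∑-∈? {suc n} (false ∷ S) = trans (∑-allFin-suc n (λ u → 𝟙 (u ∈? (false ∷ S)))) (∑-∈? S)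

  ∑-∉? : ∀ {n} (S : Subset n) → ∑ (allFin n) (λ u → 𝟙 (u ∉? S)) ≡ n ∸ ∣ S ∣
  ∑-∉? {n} S = sym (trans (cong₂ _∸_ (sym total) (refl {x = ∣ S ∣})) (m+n∸m≡n ∣ S ∣ _))
    where
    total : ∣ S ∣ + ∑ (allFin n) (λ u → 𝟙 (u ∉? S)) ≡ n
    total = trans (cong (_+ ∑ (allFin n) (λ u → 𝟙 (u ∉? S))) (sym (∑-∈? S)))
      (trans (sym (∑-distrib-+ (allFin n) _ _))
        (trans (∑-cong (allFin n) (λ u → ∈?+∉? u S)) (∑-allFin-one n)))

  ∣add∣ : ∀ {n} (S : Subset n) u → lookup S u ≡ false → ∣ add S u ∣ ≡ suc ∣ S ∣
  ∣add∣ (false ∷ S) zero    _ = refl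
  ∣add∣ (true ∷ S)  (suc u) h = cong suc (∣add∣ S u h)
  ∣add∣ (false ∷ S) (suc u) h = ∣add∣ S u h

  ∑-allSubsets-suc : ∀ n (f : Subset (suc n) → ℕ) →
    ∑ (allSubsets (suc n)) f ≡ ∑ (allSubsets n) (λ S → f (true ∷ S)) + ∑ (allSubsets n) (λ S → f (false ∷ S))
  ∑-allSubsets-suc n f = trans (∑-++ (map (true ∷_) (allSubsets n)) _ f)
    (cong₂ _+_ (∑-map (true ∷_) (allSubsets n) f) (∑-map (false ∷_) (allSubsets n) f))

  -- `add` and `remove` at `u` are inverse bijections between the sets without `u` and the sets with
  -- `u`; `ψ` receives both members of each pair.
  ∑-add≡∑-remove : ∀ {n} (u : Fin n) (ψ : Subset n → Subset n → ℕ) →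
    ∑ (allSubsets n) (λ S → 𝟙 (u ∉? S) * ψ S (add S u)) ≡ ∑ (allSubsets n) (λ A → 𝟙 (u ∈? A) * ψ (remove A u) A)
  ∑-add≡∑-remove {suc n} zero ψ =
    trans (∑-allSubsets-suc n _)
      (trans (+-comm (∑ (allSubsets n) (λ _ → 0)) _) (sym (∑-allSubsets-suc n _)))
  ∑-add≡∑-remove {suc n} (suc u) ψ =
    trans (∑-allSubsets-suc n _)
      (trans (cong₂ _+_ (∑-add≡∑-remove u (λ S A → ψ (true ∷ S) (true ∷ A)))
                        (∑-add≡∑-remove u (λ S A → ψ (false ∷ S) (false ∷ A))))
        (sym (∑-allSubsets-suc n _)))

  -- Double counting of the pairs S ⊂ A with A = S ∪ {u} and |S| = j.
  ∑-kSubsets-suc : ∀ n j (ψ : Subset n → Subset n → ℕ) →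
    ∑ (kSubsets n j) (λ S → ∑ (allFin n) (λ u → 𝟙 (u ∉? S) * ψ S (add S u))) ≡
    ∑ (kSubsets n (suc j)) (λ A → ∑ (allFin n) (λ u → 𝟙 (u ∈? A) * ψ (remove A u) A))
  ∑-kSubsets-suc n j ψ = begin-equality
    ∑ (kSubsets n j) (λ S → ∑ (allFin n) (λ u → 𝟙 (u ∉? S) * ψ S (add S u)))
      ≡⟨ ∑-filter (λ S → ∣ S ∣ ≟ j) (allSubsets n) _ ⟩
    ∑ (allSubsets n) (λ S → 𝟙 (∣ S ∣ ≟ j) * ∑ (allFin n) (λ u → 𝟙 (u ∉? S) * ψ S (add S u)))
      ≡⟨ ∑-cong (allSubsets n) (λ S → trans (sym (∑-*ˡ (allFin n) (𝟙 (∣ S ∣ ≟ j)) _)) (∑-cong (allFin n) (resize S))) ⟩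
    ∑ (allSubsets n) (λ S → ∑ (allFin n) (λ u → 𝟙 (u ∉? S) * ψ′ S (add S u)))
      ≡⟨ ∑-swap (allSubsets n) (allFin n) _ ⟩
    ∑ (allFin n) (λ u → ∑ (allSubsets n) (λ S → 𝟙 (u ∉? S) * ψ′ S (add S u)))
      ≡⟨ ∑-cong (allFin n) (λ u → ∑-add≡∑-remove u ψ′) ⟩
    ∑ (allFin n) (λ u → ∑ (allSubsets n) (λ A → 𝟙 (u ∈? A) * ψ′ (remove A u) A))
      ≡⟨ ∑-swap (allSubsets n) (allFin n) _ ⟨
    ∑ (allSubsets n) (λ A → ∑ (allFin n) (λ u → 𝟙 (u ∈? A) * ψ′ (remove A u) A))
      ≡⟨ ∑-cong (allSubsets n) (λ A → trans (∑-cong (allFin n) (λ u → e (𝟙 (u ∈? A)) (𝟙 (∣ A ∣ ≟ suc j)) _)) (∑-*ˡ (allFin n) (𝟙 (∣ A ∣ ≟ suc j)) _)) ⟩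
    ∑ (allSubsets n) (λ A → 𝟙 (∣ A ∣ ≟ suc j) * ∑ (allFin n) (λ u → 𝟙 (u ∈? A) * ψ (remove A u) A))
      ≡⟨ ∑-filter (λ A → ∣ A ∣ ≟ suc j) (allSubsets n) _ ⟨
    ∑ (kSubsets n (suc j)) (λ A → ∑ (allFin n) (λ u → 𝟙 (u ∈? A) * ψ (remove A u) A)) ∎
    where
    -- The size condition is moved from S to A = S ∪ {u}, so that after the bijection it selects the
    -- sets of size `suc j`.
    ψ′ : Subset n → Subset n → ℕ
    ψ′ S A = 𝟙 (∣ A ∣ ≟ suc j) * ψ S A
    e : ∀ a b c → a * (b * c) ≡ b * (a * c)
    e = solve-∀
    resize : ∀ S u → 𝟙 (∣ S ∣ ≟ j) * (𝟙 (u ∉? S) * ψ S (add S u)) ≡ 𝟙 (u ∉? S) * ψ′ S (add S u)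
    resize S u with u ∉? S
    ... | no _  = *-zeroʳ (𝟙 (∣ S ∣ ≟ j))
    ... | yes h = trans (e (𝟙 (∣ S ∣ ≟ j)) 1 _)
      (cong (λ z → 1 * (z * ψ S (add S u)))
        (𝟙-cong (∣ S ∣ ≟ j) (∣ add S u ∣ ≟ suc j)
          (λ p → trans (∣add∣ S u h) (cong suc p)) (λ p → suc-injective (trans (sym (∣add∣ S u h)) p))))

  ∑-kSubsets-mono : ∀ n j {f g : Subset n → ℕ} → (∀ S → ∣ S ∣ ≡ j → f S ≤ g S) →
    ∑ (kSubsets n j) f ≤ ∑ (kSubsets n j) g
  ∑-kSubsets-mono n j {f} {g} h = begin
    ∑ (kSubsets n j) f                          ≡⟨ ∑-filter size? (allSubsets n) f ⟩
    ∑ (allSubsets n) (λ S → 𝟙 (size? S) * f S)  ≤⟨ ∑-mono (allSubsets n) (λ S → 𝟙-*-mono (size? S) (h S)) ⟩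
    ∑ (allSubsets n) (λ S → 𝟙 (size? S) * g S)  ≡⟨ ∑-filter size? (allSubsets n) g ⟨
    ∑ (kSubsets n j) g                          ∎
    where
    size? : (S : Subset n) → Dec (∣ S ∣ ≡ j)
    size? S = ∣ S ∣ ≟ j

  ∑-kSubsets-cong : ∀ n j {f g : Subset n → ℕ} → (∀ S → ∣ S ∣ ≡ j → f S ≡ g S) →
    ∑ (kSubsets n j) f ≡ ∑ (kSubsets n j) g
  ∑-kSubsets-cong n j h = ≤-antisym
    (∑-kSubsets-mono n j (λ S p → ≤-reflexive (h S p)))
    (∑-kSubsets-mono n j (λ S p → ≤-reflexive (sym (h S p))))

  extend : ∀ {n} → (Subset n → ℕ) → Subset n → ℕ
  extend {n} φ S = ∑ (allFin n) (λ u → 𝟙 (u ∉? S) * φ (add S u))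

  -- The sum of φ (S ∪ {v₁, …, vⱼ}) over the sequences v₁, …, vⱼ of distinct vertices outside S.
  extendBy : ∀ {n} → ℕ → (Subset n → ℕ) → Subset n → ℕ
  extendBy zero    φ = φ
  extendBy (suc j) φ = extend (extendBy j φ)

  -- `extendBy` splits off the first vertex of the sequence; this splits off the last one instead.
  extendBy-extend : ∀ {n} j (φ : Subset n → ℕ) S → extendBy j (extend φ) S ≡ extendBy (suc j) φ S
  extendBy-extend zero    φ S = refl
  extendBy-extend {n} (suc j) φ S =
    ∑-cong (allFin n) (λ u → cong (𝟙 (u ∉? S) *_) (extendBy-extend j φ (add S u)))

  extendBy-mono : ∀ {n} j {φ χ : Subset n → ℕ} → (∀ S → φ S ≤ χ S) → ∀ S → extendBy j φ S ≤ extendBy j χ S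
  extendBy-mono zero    h S = h S
  extendBy-mono {n} (suc j) h S =
    ∑-mono (allFin n) (λ u → *-monoʳ-≤ (𝟙 (u ∉? S)) (extendBy-mono j h (add S u)))

  ∑-kSubsets-zero : ∀ n (φ : Subset n → ℕ) → ∑ (kSubsets n 0) φ ≡ φ ⊥
  ∑-kSubsets-zero n φ = trans (∑-filter (λ S → ∣ S ∣ ≟ 0) (allSubsets n) φ) (go n φ)
    where
    go : ∀ n (φ : Subset n → ℕ) → ∑ (allSubsets n) (λ S → 𝟙 (∣ S ∣ ≟ 0) * φ S) ≡ φ ⊥
    go zero    φ = trans (+-identityʳ _) (+-identityʳ _)
    go (suc n) φ = trans (∑-allSubsets-suc n _)
      (cong₂ _+_ (∑-zero (allSubsets n)) (go n (λ S → φ (false ∷ S))))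

  -- Each `j`-set comes from `j !` sequences. In the induction the last vertex is split off, and the
  -- double counting yields the factor `suc j` for its possible choices.
  extendBy-⊥ : ∀ {n} j (φ : Subset n → ℕ) → extendBy j φ ⊥ ≡ j ! * ∑ (kSubsets n j) φ
  extendBy-⊥ {n} zero    φ = trans (sym (∑-kSubsets-zero n φ)) (sym (+-identityʳ _))
  extendBy-⊥ {n} (suc j) φ = begin-equality
    extendBy (suc j) φ ⊥                   ≡⟨ extendBy-extend j φ ⊥ ⟨
    extendBy j (extend φ) ⊥                ≡⟨ extendBy-⊥ j (extend φ) ⟩
    j ! * ∑ (kSubsets n j) (extend φ)      ≡⟨ cong (j ! *_) (∑-kSubsets-suc n j (λ _ A → φ A)) ⟩
    j ! * ∑ (kSubsets n (suc j)) (λ A → ∑ (allFin n) (λ u → 𝟙 (u ∈? A) * φ A))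
      ≡⟨ cong (j ! *_) (∑-kSubsets-cong n (suc j) (λ A p → trans (∑-*ʳ (allFin n) _ (φ A)) (cong (_* φ A) (trans (∑-∈? A) p)))) ⟩
    j ! * ∑ (kSubsets n (suc j)) (λ A → suc j * φ A)
      ≡⟨ cong (j ! *_) (∑-*ˡ (kSubsets n (suc j)) (suc j) φ) ⟩
    j ! * (suc j * ∑ (kSubsets n (suc j)) φ)  ≡⟨ e (j !) (suc j) _ ⟩
    suc j ! * ∑ (kSubsets n (suc j)) φ     ∎
    where
    e : ∀ a b c → a * (b * c) ≡ b * a * c
    e = solve-∀

  -- While at most k vertices are used, at least n - k are left for the next choice.
  extendBy-one : ∀ {n} k j (S : Subset n) → j + ∣ S ∣ ≤ k → (n ∸ k) ^ j ≤ extendBy j (λ _ → 1) S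
  extendBy-one k zero    S h = ≤-refl
  extendBy-one {n} k (suc j) S h = begin
    (n ∸ k) * (n ∸ k) ^ j                               ≤⟨ *-monoˡ-≤ ((n ∸ k) ^ j) (∸-monoʳ-≤ n (m+n≤o⇒n≤o (suc j) h)) ⟩
    (n ∸ ∣ S ∣) * (n ∸ k) ^ j                           ≡⟨ cong (_* (n ∸ k) ^ j) (∑-∉? S) ⟨
    ∑ (allFin n) (λ u → 𝟙 (u ∉? S)) * (n ∸ k) ^ j       ≡⟨ ∑-*ʳ (allFin n) _ _ ⟨
    ∑ (allFin n) (λ u → 𝟙 (u ∉? S) * (n ∸ k) ^ j)       ≤⟨ ∑-mono (allFin n) (λ u → 𝟙-*-mono (u ∉? S) (λ p →
      extendBy-one k j (add S u) (≤-trans (≤-reflexive (trans (cong (j +_) (∣add∣ S u p)) (+-suc j ∣ S ∣))) h))) ⟩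
    extendBy (suc j) (λ _ → 1) S                        ∎

  -- A lower bound for the denominator of `I`: multiplied by `k !` it is the number of sequences of
  -- k distinct vertices.
  kSubsets-count : ∀ n k → (n ∸ k) ^ k ≤ k ! * length (kSubsets n k)
  kSubsets-count n k = begin
    (n ∸ k) ^ k                          ≤⟨ extendBy-one k k ⊥ (≤-reflexive (trans (cong (k +_) (∣⊥∣≡0 n)) (+-identityʳ k))) ⟩
    extendBy k (λ _ → 1) (⊥ {n})         ≡⟨ extendBy-⊥ k (λ _ → 1) ⟩
    k ! * ∑ (kSubsets n k) (λ _ → 1)     ≡⟨ cong (k ! *_) (∑-one (kSubsets n k)) ⟩
    k ! * length (kSubsets n k)          ∎

-- The number of edges inside a vertex set.

module Edges where

  open import Data.Nat using (_+_)
  open ≤-Reasoning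
  open Sums
  open Subsets

  -- The pointwise form of `subsetᵇ`, suited to changing a set at a single vertex.
  _⊑_ : ∀ {n} → Subset n → Subset n → Set
  f ⊑ S = ∀ i → lookup f i ≡ true → lookup S i ≡ true

  subsetᵇ⇒⊑ : ∀ {n} (f S : Subset n) → subsetᵇ f S ≡ true → f ⊑ S
  subsetᵇ⇒⊑ (true ∷ f)  (true ∷ S) h zero    p = refl
  subsetᵇ⇒⊑ (true ∷ f)  (true ∷ S) h (suc i) p = subsetᵇ⇒⊑ f S h i p
  subsetᵇ⇒⊑ (false ∷ f) (x ∷ S)    h (suc i) p = subsetᵇ⇒⊑ f S h i p

  ⊑⇒subsetᵇ : ∀ {n} (f S : Subset n) → f ⊑ S → subsetᵇ f S ≡ true
  ⊑⇒subsetᵇ []          []          h = refl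
  ⊑⇒subsetᵇ (true ∷ f)  (true ∷ S)  h = ⊑⇒subsetᵇ f S (h ∘ suc)
  ⊑⇒subsetᵇ (true ∷ f)  (false ∷ S) h with h zero refl
  ... | ()
  ⊑⇒subsetᵇ (false ∷ f) (x ∷ S)     h = ⊑⇒subsetᵇ f S (h ∘ suc)

  lookup-add : ∀ {n} (S : Subset n) u i → lookup S i ≡ true → lookup (add S u) i ≡ true
  lookup-add S u i h with i ≟ᶠ u
  ... | yes refl = lookup∘update u S true
  ... | no i≢u   = trans (lookup∘update′ i≢u S true) h

  ⊑-add : ∀ {n} (f S : Subset n) u → f ⊑ S → f ⊑ add S u
  ⊑-add f S u h i p = lookup-add S u i (h i p)

  -- For u ≠ v the sets S ∪ {u} and S ∪ {v} meet in S.
  ⊑-add-∩ : ∀ {n} (f S : Subset n) {u v} → u ≢ v → f ⊑ add S u → f ⊑ add S v → f ⊑ S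
  ⊑-add-∩ f S {u} {v} u≢v h h′ i p with i ≟ᶠ u
  ... | yes refl = trans (sym (lookup∘update′ u≢v S true)) (h′ i p)
  ... | no i≢u   = trans (sym (lookup∘update′ i≢u S true)) (h i p)

  ⊑-remove : ∀ {n} (f A : Subset n) u → lookup f u ≢ true → f ⊑ A → f ⊑ remove A u
  ⊑-remove f A u u∉f h i p with i ≟ᶠ u
  ... | yes refl = ⊥-elim (u∉f p)
  ... | no i≢u   = trans (lookup∘update′ i≢u A false) (h i p)

  remove-⊑ : ∀ {n} (f A : Subset n) u → f ⊑ remove A u → f ⊑ A
  remove-⊑ f A u h i p with i ≟ᶠ u
  ... | yes refl = ⊥-elim (absurd (trans (sym (lookup∘update u A false)) (h u p)))
    where
    absurd : false ≢ true
    absurd ()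
  ... | no i≢u   = trans (sym (lookup∘update′ i≢u A false)) (h i p)

  module _ {n : ℕ} (G : Hypergraph n) where

    edge? : (f S : Subset n) → Dec (G f ∧ subsetᵇ f S ≡ true)
    edge? f S = G f ∧ subsetᵇ f S ≟ᵇ true

    edge⇒G : ∀ f S → G f ∧ subsetᵇ f S ≡ true → G f ≡ true
    edge⇒G f S = ∧-conicalˡ (G f) (subsetᵇ f S)

    edge⇒⊑ : ∀ f S → G f ∧ subsetᵇ f S ≡ true → f ⊑ S
    edge⇒⊑ f S h = subsetᵇ⇒⊑ f S (∧-conicalʳ (G f) (subsetᵇ f S) h)

    mkEdge : ∀ f S → G f ≡ true → f ⊑ S → G f ∧ subsetᵇ f S ≡ true
    mkEdge f S g h = cong₂ _∧_ g (⊑⇒subsetᵇ f S h)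

    edge-mono : ∀ f S S′ → (f ⊑ S → f ⊑ S′) → G f ∧ subsetᵇ f S ≡ true → G f ∧ subsetᵇ f S′ ≡ true
    edge-mono f S S′ h p = mkEdge f S′ (edge⇒G f S p) (h (edge⇒⊑ f S p))

    edgesIn-∑ : ∀ S → edgesIn G S ≡ ∑ (allSubsets n) (λ f → 𝟙 (edge? f S))
    edgesIn-∑ S = trans (length-filter (λ f → T? (G f ∧ subsetᵇ f S)) (allSubsets n))
      (∑-cong (allSubsets n) (λ f → 𝟙-cong (T? (G f ∧ subsetᵇ f S)) (edge? f S)
        (Equivalence.to T-≡) (Equivalence.from T-≡)))

    edgesIn-mono : ∀ S S′ → (∀ f → f ⊑ S → f ⊑ S′) → edgesIn G S ≤ edgesIn G S′
    edgesIn-mono S S′ h = begin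
      edgesIn G S                              ≡⟨ edgesIn-∑ S ⟩
      ∑ (allSubsets n) (λ f → 𝟙 (edge? f S))   ≤⟨ ∑-mono (allSubsets n) (λ f → 𝟙-mono (edge? f S) (edge? f S′) (edge-mono f S S′ (h f))) ⟩
      ∑ (allSubsets n) (λ f → 𝟙 (edge? f S′))  ≡⟨ edgesIn-∑ S′ ⟨
      edgesIn G S′                             ∎

    edgesIn-add : ∀ S u → edgesIn G S ≤ edgesIn G (add S u)
    edgesIn-add S u = edgesIn-mono S (add S u) (λ f → ⊑-add f S u)

    -- Edge by edge: an edge inside both S ∪ {u} and S ∪ {v} lies in S and so counts twice on the
    -- right; an edge inside only one of them still lies in their union.
    edgesIn-supermodular : ∀ S {u v} → u ≢ v →
      edgesIn G (add S u) + edgesIn G (add S v) ≤ edgesIn G S + edgesIn G (add (add S v) u)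
    edgesIn-supermodular S {u} {v} u≢v = begin
      edgesIn G (add S u) + edgesIn G (add S v)
        ≡⟨ cong₂ _+_ (edgesIn-∑ (add S u)) (edgesIn-∑ (add S v)) ⟩
      ∑ (allSubsets n) (λ f → 𝟙 (edge? f (add S u))) + ∑ (allSubsets n) (λ f → 𝟙 (edge? f (add S v)))
        ≡⟨ ∑-distrib-+ (allSubsets n) _ _ ⟨
      ∑ (allSubsets n) (λ f → 𝟙 (edge? f (add S u)) + 𝟙 (edge? f (add S v)))
        ≤⟨ ∑-mono (allSubsets n) pointwise ⟩
      ∑ (allSubsets n) (λ f → 𝟙 (edge? f S) + 𝟙 (edge? f (add (add S v) u)))
        ≡⟨ ∑-distrib-+ (allSubsets n) _ _ ⟩
      ∑ (allSubsets n) (λ f → 𝟙 (edge? f S)) + ∑ (allSubsets n) (λ f → 𝟙 (edge? f (add (add S v) u)))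
        ≡⟨ cong₂ _+_ (edgesIn-∑ S) (edgesIn-∑ (add (add S v) u)) ⟨
      edgesIn G S + edgesIn G (add (add S v) u) ∎
      where
      pointwise : ∀ f → 𝟙 (edge? f (add S u)) + 𝟙 (edge? f (add S v)) ≤ 𝟙 (edge? f S) + 𝟙 (edge? f (add (add S v) u))
      pointwise f = go (edge? f (add S u)) (edge? f (add S v))
        where
        W = add (add S v) u
        fromV : G f ∧ subsetᵇ f (add S v) ≡ true → G f ∧ subsetᵇ f W ≡ true
        fromV = edge-mono f (add S v) W (⊑-add f (add S v) u)
        fromU : G f ∧ subsetᵇ f (add S u) ≡ true → G f ∧ subsetᵇ f W ≡ true
        fromU = edge-mono f (add S u) W (λ h → subst (f ⊑_) ([]≔-commutes S u v u≢v) (⊑-add f (add S u) v h))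
        go : (d : Dec (G f ∧ subsetᵇ f (add S u) ≡ true)) (d′ : Dec (G f ∧ subsetᵇ f (add S v) ≡ true)) →
          𝟙 d + 𝟙 d′ ≤ 𝟙 (edge? f S) + 𝟙 (edge? f W)
        go (yes p) (yes q) = ≤-reflexive (sym (cong₂ _+_
          (𝟙-yes (edge? f S) (mkEdge f S (edge⇒G f (add S u) p)
            (⊑-add-∩ f S u≢v (edge⇒⊑ f (add S u) p) (edge⇒⊑ f (add S v) q))))
          (𝟙-yes (edge? f W) (fromU p))))
        go (yes p) (no _)  = m≤n⇒m≤o+n (𝟙 (edge? f S)) (≤-reflexive (sym (𝟙-yes (edge? f W) (fromU p))))
        go (no _)  (yes q) = m≤n⇒m≤o+n (𝟙 (edge? f S)) (≤-reflexive (sym (𝟙-yes (edge? f W) (fromV q))))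
        go (no _)  (no _)  = z≤n

    -- By supermodularity the number of edges gained with `u` cannot drop when `v` is already
    -- present.
    edgesIn-add-strict : ∀ S {u v} → u ≢ v → edgesIn G S < edgesIn G (add S u) →
      edgesIn G (add S v) < edgesIn G (add (add S v) u)
    edgesIn-add-strict S {u} {v} u≢v lt = +-cancelˡ-≤ (edgesIn G S) _ _ (begin
      edgesIn G S + suc (edgesIn G (add S v))           ≡⟨ +-suc (edgesIn G S) _ ⟩
      suc (edgesIn G S) + edgesIn G (add S v)           ≤⟨ +-monoˡ-≤ (edgesIn G (add S v)) lt ⟩
      edgesIn G (add S u) + edgesIn G (add S v)         ≤⟨ edgesIn-supermodular S u≢v ⟩
      edgesIn G S + edgesIn G (add (add S v) u)         ∎)

    -- Every edge lost with `u` contains `u`, so the loss is at most the degree of `u` inside `A`,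
    -- which is the sum on the right.
    edgesIn-remove : ∀ A u → edgesIn G A ≤ edgesIn G (remove A u) + ∑ (allSubsets n) (λ f → 𝟙 (edge? f A) * 𝟙 (u ∈? f))
    edgesIn-remove A u = begin
      edgesIn G A                              ≡⟨ edgesIn-∑ A ⟩
      ∑ (allSubsets n) (λ f → 𝟙 (edge? f A))   ≤⟨ ∑-mono (allSubsets n) pointwise ⟩
      ∑ (allSubsets n) (λ f → 𝟙 (edge? f (remove A u)) + 𝟙 (edge? f A) * 𝟙 (u ∈? f)) ≡⟨ ∑-distrib-+ (allSubsets n) _ _ ⟩
      ∑ (allSubsets n) (λ f → 𝟙 (edge? f (remove A u))) + ∑ (allSubsets n) (λ f → 𝟙 (edge? f A) * 𝟙 (u ∈? f))
        ≡⟨ cong (_+ ∑ (allSubsets n) (λ f → 𝟙 (edge? f A) * 𝟙 (u ∈? f))) (edgesIn-∑ (remove A u)) ⟨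
      edgesIn G (remove A u) + ∑ (allSubsets n) (λ f → 𝟙 (edge? f A) * 𝟙 (u ∈? f)) ∎
      where
      pointwise : ∀ f → 𝟙 (edge? f A) ≤ 𝟙 (edge? f (remove A u)) + 𝟙 (edge? f A) * 𝟙 (u ∈? f)
      pointwise f = go (u ∈? f)
        where
        go : (d : Dec (lookup f u ≡ true)) → 𝟙 (edge? f A) ≤ 𝟙 (edge? f (remove A u)) + 𝟙 (edge? f A) * 𝟙 d
        go (yes _)   = m≤n⇒m≤o+n (𝟙 (edge? f (remove A u))) (≤-reflexive (sym (*-identityʳ (𝟙 (edge? f A)))))
        go (no u∉f)  = m≤n⇒m≤n+o (𝟙 (edge? f A) * 0) (𝟙-mono (edge? f A) (edge? f (remove A u))
          (edge-mono f A (remove A u) (⊑-remove f A u u∉f)))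

    module _ (r : ℕ) (small : EdgesAtMost r G) where

      -- `small` makes every edge non-empty.
      edgesIn-⊥ : edgesIn G ⊥ ≡ 0
      edgesIn-⊥ = trans (edgesIn-∑ ⊥)
        (trans (∑-cong (allSubsets n) (λ f → 𝟙-no (edge? f ⊥) (noEdge f))) (∑-zero (allSubsets n)))
        where
        noEdge : ∀ f → ¬ (G f ∧ subsetᵇ f ⊥ ≡ true)
        noEdge f p = <⇒≱ (proj₁ (small f (edge⇒G f ⊥ p))) (begin
          ∣ f ∣                                 ≡⟨ ∑-∈? f ⟨
          ∑ (allFin n) (λ u → 𝟙 (u ∈? f))       ≡⟨ ∑-cong (allFin n) (λ u → 𝟙-no (u ∈? f) (λ q → absurd (trans (sym (lookup-replicate u false)) (edge⇒⊑ f ⊥ p u q)))) ⟩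
          ∑ (allFin n) (λ _ → 0)                ≡⟨ ∑-zero (allFin n) ⟩
          0                                     ∎)
          where
          absurd : false ≢ true
          absurd ()

      -- Handshake double counting: each edge inside `A` is counted once for each of its at most `r`
      -- vertices.
      ∑-degrees : ∀ A → ∑ (allFin n) (λ u → ∑ (allSubsets n) (λ f → 𝟙 (edge? f A) * 𝟙 (u ∈? f))) ≤ r * edgesIn G A
      ∑-degrees A = begin
        ∑ (allFin n) (λ u → ∑ (allSubsets n) (λ f → 𝟙 (edge? f A) * 𝟙 (u ∈? f)))  ≡⟨ ∑-swap (allFin n) (allSubsets n) _ ⟩
        ∑ (allSubsets n) (λ f → ∑ (allFin n) (λ u → 𝟙 (edge? f A) * 𝟙 (u ∈? f)))  ≡⟨ ∑-cong (allSubsets n) (λ f → trans (∑-*ˡ (allFin n) (𝟙 (edge? f A)) _) (cong (𝟙 (edge? f A) *_) (∑-∈? f))) ⟩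
        ∑ (allSubsets n) (λ f → 𝟙 (edge? f A) * ∣ f ∣)                            ≤⟨ ∑-mono (allSubsets n) pointwise ⟩
        ∑ (allSubsets n) (λ f → r * 𝟙 (edge? f A))                                ≡⟨ ∑-*ˡ (allSubsets n) r _ ⟩
        r * ∑ (allSubsets n) (λ f → 𝟙 (edge? f A))                                ≡⟨ cong (r *_) (edgesIn-∑ A) ⟨
        r * edgesIn G A                                                           ∎
        where
        pointwise : ∀ f → 𝟙 (edge? f A) * ∣ f ∣ ≤ r * 𝟙 (edge? f A)
        pointwise f = ≤-trans (𝟙-*-mono (edge? f A) (λ p → proj₂ (small f (edge⇒G f A p)))) (≤-reflexive (*-comm (𝟙 (edge? f A)) r))

      -- A vertex whose removal destroys an edge lies in one of the at most ℓ edges, each of size at most r.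
      isolated-count : ∀ ℓ A → edgesIn G A ≡ ℓ →
        ∣ A ∣ ∸ r * ℓ ≤ ∑ (allFin n) (λ u → 𝟙 (u ∈? A) * 𝟙 (edgesIn G (remove A u) ≟ ℓ))
      isolated-count ℓ A refl = m≤n+o⇒m∸n≤o ∣ A ∣ (r * ℓ) (begin
        ∣ A ∣                                                              ≡⟨ ∑-∈? A ⟨
        ∑ (allFin n) (λ u → 𝟙 (u ∈? A))                                    ≤⟨ ∑-mono (allFin n) pointwise ⟩
        ∑ (allFin n) (λ u → degree u + 𝟙 (u ∈? A) * 𝟙 (iso? u))            ≡⟨ ∑-distrib-+ (allFin n) degree _ ⟩
        ∑ (allFin n) degree + ∑ (allFin n) (λ u → 𝟙 (u ∈? A) * 𝟙 (iso? u)) ≤⟨ +-monoˡ-≤ _ (∑-degrees A) ⟩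
        r * ℓ + ∑ (allFin n) (λ u → 𝟙 (u ∈? A) * 𝟙 (iso? u))               ∎)
        where
        degree : Fin n → ℕ
        degree u = ∑ (allSubsets n) (λ f → 𝟙 (edge? f A) * 𝟙 (u ∈? f))
        iso? : ∀ u → Dec (edgesIn G (remove A u) ≡ ℓ)
        iso? u = edgesIn G (remove A u) ≟ ℓ
        pointwise : ∀ u → 𝟙 (u ∈? A) ≤ degree u + 𝟙 (u ∈? A) * 𝟙 (iso? u)
        pointwise u = go (iso? u)
          where
          go : (d : Dec (edgesIn G (remove A u) ≡ ℓ)) → 𝟙 (u ∈? A) ≤ degree u + 𝟙 (u ∈? A) * 𝟙 d
          go (yes _) = m≤n⇒m≤o+n (degree u) (≤-reflexive (sym (*-identityʳ _)))
          go (no ¬p) = m≤n⇒m≤n+o (𝟙 (u ∈? A) * 0) (≤-trans (𝟙≤1 (u ∈? A))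
            (+-cancelˡ-≤ (edgesIn G (remove A u)) 1 (degree u) (begin
              edgesIn G (remove A u) + 1  ≡⟨ +-comm _ 1 ⟩
              suc (edgesIn G (remove A u)) ≤⟨ ≤∧≢⇒< (edgesIn-mono (remove A u) A (λ f → remove-⊑ f A u)) ¬p ⟩
              ℓ                           ≤⟨ edgesIn-remove A u ⟩
              edgesIn G (remove A u) + degree u ∎)))

-- Counting the sequences that reach ℓ edges.

module Counting where

  open import Data.Nat using (_+_)
  open ≤-Reasoning
  open Inequalities
  open Sums
  open Subsets
  open Edges

  module _ {n : ℕ} (G : Hypergraph n) (ℓ : ℕ) where

    exact? : (S : Subset n) → Dec (edgesIn G S ≡ ℓ)
    exact? S = edgesIn G S ≟ ℓ

    below? : (S : Subset n) → Dec (edgesIn G S < ℓ)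
    below? S = edgesIn G S <? ℓ

    -- Under `extendBy`, `staysExact` counts the sequences whose last vertex leaves the edge count
    -- at ℓ, which is the event to be bounded; `below` describes what remains after the completing
    -- vertex has been moved to the end.
    exact below staysExact : Subset n → ℕ
    exact S = 𝟙 (exact? S)
    below S = 𝟙 (below? S)
    staysExact S = exact S * extend exact S

    -- Deleting the vertex u from the extension destroys an edge, so ℓ edges become fewer.
    exact≤below : ∀ j S u → edgesIn G S < edgesIn G (add S u) → extendBy j exact (add S u) ≤ extendBy j below S
    exact≤below zero    S u lt = 𝟙-mono (exact? (add S u)) (below? S) (λ p → subst (edgesIn G S <_) p lt)
    exact≤below (suc j) S u lt = ∑-mono (allFin n) (λ v → 𝟙-≤ (v ∉? add S u) (pointwise v))
      where
      absurd : true ≢ false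
      absurd ()
      pointwise : ∀ v → lookup (add S u) v ≡ false →
        extendBy j exact (add (add S u) v) ≤ 𝟙 (v ∉? S) * extendBy j below (add S v)
      pointwise v p with v ≟ᶠ u
      ... | yes refl = ⊥-elim (absurd (trans (sym (lookup∘update u S true)) p))
      ... | no v≢u   = begin
        extendBy j exact (add (add S u) v)       ≡⟨ cong (extendBy j exact) ([]≔-commutes S u v u≢v) ⟩
        -- The strict gain from `u` persists once `v` is added, so the induction continues over S ∪
        -- {v}.
        extendBy j exact (add (add S v) u)       ≤⟨ exact≤below j (add S v) u (edgesIn-add-strict G S u≢v lt) ⟩
        extendBy j below (add S v)               ≡⟨ *-identityˡ _ ⟨
        1 * extendBy j below (add S v)           ≡⟨ cong (_* extendBy j below (add S v)) (𝟙-yes (v ∉? S) (trans (sym (lookup∘update′ v≢u S true)) p)) ⟨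
        𝟙 (v ∉? S) * extendBy j below (add S v)  ∎
        where
        u≢v : u ≢ v
        u≢v q = v≢u (sym q)

    -- The edge count never falls when vertices are added.
    extendBy-below-none : ∀ j S → ¬ (edgesIn G S < ℓ) → extendBy j below S ≡ 0
    extendBy-below-none zero    S h = 𝟙-no (below? S) h
    extendBy-below-none (suc j) S h = trans
      (∑-cong (allFin n) (λ u → trans
        (cong (𝟙 (u ∉? S) *_) (extendBy-below-none j (add S u) (λ lt → h (≤-<-trans (edgesIn-add G S u) lt))))
        (*-zeroʳ (𝟙 (u ∉? S)))))
      (∑-zero (allFin n))

    staysExact≤extend : ∀ S → staysExact S ≤ extend exact S
    staysExact≤extend S = 𝟙-≤ (exact? S) (λ _ → ≤-refl)

    -- `killers S` is the number Q of vertices completing at least ℓ edges with `S`; the survivors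
    -- are the other vertices outside `S`.
    survivors killers : Subset n → ℕ
    survivors S = ∑ (allFin n) (λ u → 𝟙 (u ∉? S) * below (add S u))
    killers   S = ∑ (allFin n) (λ u → 𝟙 (u ∉? S) * 𝟙 (¬? (below? (add S u))))

    survivors+killers≤n : ∀ S → survivors S + killers S ≤ n
    survivors+killers≤n S = begin
      survivors S + killers S                                    ≡⟨ ∑-distrib-+ (allFin n) _ _ ⟨
      ∑ (allFin n) (λ u → 𝟙 (u ∉? S) * below (add S u) + 𝟙 (u ∉? S) * 𝟙 (¬? (below? (add S u))))
                                                                 ≤⟨ ∑-mono (allFin n) (λ u → pointwise (u ∉? S) (below? (add S u))) ⟩
      ∑ (allFin n) (λ _ → 1)                                     ≡⟨ ∑-allFin-one n ⟩
      n                                                          ∎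
      where
      pointwise : {P Q : Set} (d : Dec P) (d′ : Dec Q) → 𝟙 d * 𝟙 d′ + 𝟙 d * 𝟙 (¬? d′) ≤ 1
      pointwise (yes _) (yes _) = ≤-refl
      pointwise (yes _) (no _)  = ≤-refl
      pointwise (no _)  _       = z≤n

    -- A sequence that starts with a killer never returns below ℓ edges, so only survivors
    -- contribute as first vertex.
    below-split : ∀ i S →
      extendBy (suc i) below S ≤ ∑ (allFin n) (λ u → 𝟙 (u ∉? S) * below (add S u) * extendBy i below (add S u))
    below-split i S = ∑-mono (allFin n) (λ u → pointwise u (below? (add S u)))
      where
      pointwise : ∀ u (d : Dec (edgesIn G (add S u) < ℓ)) →
        𝟙 (u ∉? S) * extendBy i below (add S u) ≤ 𝟙 (u ∉? S) * 𝟙 d * extendBy i below (add S u)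
      pointwise u (yes _) = *-monoˡ-≤ (extendBy i below (add S u)) (≤-reflexive (sym (*-identityʳ (𝟙 (u ∉? S)))))
      pointwise u (no ¬p) = ≤-trans
        (≤-reflexive (trans (cong (𝟙 (u ∉? S) *_) (extendBy-below-none i (add S u) ¬p)) (*-zeroʳ (𝟙 (u ∉? S))))) z≤n

    -- If v₁ already completes ℓ edges, it is moved to the end of the sequence.
    staysExact-split : ∀ i S → edgesIn G S < ℓ → extendBy (suc i) staysExact S ≤
      killers S * extendBy (suc i) below S + ∑ (allFin n) (λ u → 𝟙 (u ∉? S) * below (add S u) * extendBy i staysExact (add S u))
    staysExact-split i S lt = begin
      extendBy (suc i) staysExact S
        ≤⟨ ∑-mono (allFin n) (λ u → pointwise u (u ∉? S) (below? (add S u))) ⟩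
      ∑ (allFin n) (λ u → 𝟙 (u ∉? S) * 𝟙 (¬? (below? (add S u))) * b + 𝟙 (u ∉? S) * below (add S u) * t u)
        ≡⟨ ∑-distrib-+ (allFin n) _ _ ⟩
      ∑ (allFin n) (λ u → 𝟙 (u ∉? S) * 𝟙 (¬? (below? (add S u))) * b) + ∑ (allFin n) (λ u → 𝟙 (u ∉? S) * below (add S u) * t u)
        ≡⟨ cong (_+ ∑ (allFin n) (λ u → 𝟙 (u ∉? S) * below (add S u) * t u)) (∑-*ʳ (allFin n) _ b) ⟩
      killers S * b + ∑ (allFin n) (λ u → 𝟙 (u ∉? S) * below (add S u) * t u) ∎
      where
      b = extendBy (suc i) below S
      t : Fin n → ℕ
      t u = extendBy i staysExact (add S u)
      moved : ∀ u → ¬ (edgesIn G (add S u) < ℓ) → t u ≤ b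
      moved u ¬p = begin
        -- The condition before the last vertex is dropped, so that `exact≤below` can delete `u`
        -- from a sequence whose other `suc i` vertices extend `S`.
        extendBy i staysExact (add S u)      ≤⟨ extendBy-mono i staysExact≤extend (add S u) ⟩
        extendBy i (extend exact) (add S u)  ≡⟨ extendBy-extend i exact (add S u) ⟩
        extendBy (suc i) exact (add S u)     ≤⟨ exact≤below (suc i) S u (<-≤-trans lt (≮⇒≥ ¬p)) ⟩
        b                                    ∎
      pointwise : ∀ u {P : Set} (d : Dec P) (d′ : Dec (edgesIn G (add S u) < ℓ)) →
        𝟙 d * t u ≤ 𝟙 d * 𝟙 (¬? d′) * b + 𝟙 d * 𝟙 d′ * t u
      pointwise u (no _)  _       = z≤n
      pointwise u (yes _) (yes _) = ≤-refl
      pointwise u (yes _) (no ¬p) = ≤-trans (*-monoʳ-≤ 1 (moved u ¬p)) (≤-reflexive (sym (+-identityʳ _)))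

    -- `x` is the sum of `killers` over the prefixes already passed, a weight carried by every
    -- sequence that stays below ℓ edges. With h_t survivors and q_t killers at step t, the count is
    -- governed by the product of h_1, ..., h_j and x + q_1 + ⋯ + q_j. Since h_t + q_t ≤ n, these j
    -- + 1 factors add up to at most n j + x, and AM-GM gives the right-hand side. The induction
    -- uses AM-GM one step at a time because later factors depend on the vertices chosen.
    extension-bound : ∀ j S x → edgesIn G S < ℓ →
      (x * extendBy j below S + extendBy j staysExact S) * suc j ^ suc j ≤ (n * j + x) ^ suc j
    extension-bound zero S x lt = begin
      (x * below S + staysExact S) * 1  ≡⟨ *-identityʳ _ ⟩
      x * below S + staysExact S        ≡⟨ cong₂ (λ y z → x * y + z * extend exact S) (𝟙-yes (below? S) lt) (𝟙-no (exact? S) (<⇒≢ lt)) ⟩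
      x * 1 + 0                         ≡⟨ e n x ⟩
      (n * 0 + x) * 1                   ∎
      where
      e : ∀ n x → x * 1 + 0 ≡ (n * 0 + x) * 1
      e = solve-∀
    -- `p` clears the denominator of the inductive hypothesis for `i`.
    extension-bound (suc i) S x lt = *-cancelʳ-≤ _ _ p {{m^n≢0 (suc i) (suc i)}} (begin
      (x * b + extendBy (suc i) staysExact S) * suc (suc i) ^ suc (suc i) * p
        ≡⟨ e₀ (x * b + extendBy (suc i) staysExact S) (suc (suc i) ^ suc (suc i)) p ⟩
      suc (suc i) ^ suc (suc i) * ((x * b + extendBy (suc i) staysExact S) * p)
        ≤⟨ *-monoʳ-≤ (suc (suc i) ^ suc (suc i)) one-step ⟩
      suc (suc i) ^ suc (suc i) * (survivors S * c ^ suc i)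
        ≤⟨ weighted-am-gm (survivors S) c (suc i) ⟩
      p * (survivors S + c) ^ suc (suc i)
        ≤⟨ *-monoʳ-≤ p (^-monoˡ-≤ (suc (suc i)) total) ⟩
      p * (n * suc i + x) ^ suc (suc i)
        ≡⟨ *-comm p _ ⟩
      (n * suc i + x) ^ suc (suc i) * p ∎)
      where
      p = suc i ^ suc i
      q = killers S
      -- The base of the power in the inductive hypothesis with `x + q` for `x`: a bound for the sum
      -- of all factors other than `survivors S`.
      c = n * i + (x + q)
      b = extendBy (suc i) below S
      g B E : Fin n → ℕ
      g u = 𝟙 (u ∉? S) * below (add S u)
      B u = extendBy i below (add S u)
      E u = extendBy i staysExact (add S u)
      e₀ : ∀ a b c → a * b * c ≡ b * (a * c)
      e₀ = solve-∀
      e₁ : ∀ x b q s → x * b + (q * b + s) ≡ (x + q) * b + s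
      e₁ = solve-∀
      e₂ : ∀ g z B E p → (z * (g * B) + g * E) * p ≡ g * ((z * B + E) * p)
      e₂ = solve-∀
      e₃ : ∀ n i x h q → h + (n * i + (x + q)) ≡ (h + q) + (n * i + x)
      e₃ = solve-∀
      e₄ : ∀ n i x → n + (n * i + x) ≡ n * suc i + x
      e₄ = solve-∀
      total : survivors S + c ≤ n * suc i + x
      total = begin
        survivors S + c                   ≡⟨ e₃ n i x (survivors S) q ⟩
        survivors S + q + (n * i + x)     ≤⟨ +-monoˡ-≤ (n * i + x) (survivors+killers≤n S) ⟩
        n + (n * i + x)                   ≡⟨ e₄ n i x ⟩
        n * suc i + x                     ∎
      recurse : ∀ u → (((x + q) * (g u * B u) + g u * E u) * p) ≤ g u * c ^ suc i
      recurse u = begin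
        ((x + q) * (g u * B u) + g u * E u) * p   ≡⟨ e₂ (g u) (x + q) (B u) (E u) p ⟩
        g u * (((x + q) * B u + E u) * p)         ≡⟨ *-assoc (𝟙 (u ∉? S)) _ _ ⟩
        𝟙 (u ∉? S) * (below (add S u) * (((x + q) * B u + E u) * p))
          -- The factor `below (add S u)` supplies the hypothesis of the recursive call.
          ≤⟨ *-monoʳ-≤ (𝟙 (u ∉? S)) (𝟙-*-mono (below? (add S u)) (extension-bound i (add S u) (x + q))) ⟩
        𝟙 (u ∉? S) * (below (add S u) * c ^ suc i) ≡⟨ *-assoc (𝟙 (u ∉? S)) _ _ ⟨
        g u * c ^ suc i                           ∎
      one-step : (x * b + extendBy (suc i) staysExact S) * p ≤ survivors S * c ^ suc i
      one-step = begin
        (x * b + extendBy (suc i) staysExact S) * p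
          ≤⟨ *-monoˡ-≤ p (+-monoʳ-≤ (x * b) (staysExact-split i S lt)) ⟩
        (x * b + (q * b + ∑ (allFin n) (λ u → g u * E u))) * p
          ≡⟨ cong (_* p) (e₁ x b q _) ⟩
        ((x + q) * b + ∑ (allFin n) (λ u → g u * E u)) * p
          ≤⟨ *-monoˡ-≤ p (+-monoˡ-≤ _ (*-monoʳ-≤ (x + q) (below-split i S))) ⟩
        ((x + q) * ∑ (allFin n) (λ u → g u * B u) + ∑ (allFin n) (λ u → g u * E u)) * p
          ≡⟨ cong (λ z → (z + ∑ (allFin n) (λ u → g u * E u)) * p) (∑-*ˡ (allFin n) (x + q) _) ⟨
        (∑ (allFin n) (λ u → (x + q) * (g u * B u)) + ∑ (allFin n) (λ u → g u * E u)) * p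
          ≡⟨ cong (_* p) (∑-distrib-+ (allFin n) _ _) ⟨
        ∑ (allFin n) (λ u → (x + q) * (g u * B u) + g u * E u) * p
          ≡⟨ ∑-*ʳ (allFin n) _ p ⟨
        ∑ (allFin n) (λ u → ((x + q) * (g u * B u) + g u * E u) * p)
          ≤⟨ ∑-mono (allFin n) recurse ⟩
        ∑ (allFin n) (λ u → g u * c ^ suc i)
          ≡⟨ ∑-*ʳ (allFin n) g (c ^ suc i) ⟩
        survivors S * c ^ suc i ∎

    -- Written like the numerator in `I`, so that the two agree by computation.
    exactCount : ℕ → ℕ
    exactCount k = length (filter (λ S → edgesIn G S ≟ ℓ) (kSubsets n k))

    module _ (r : ℕ) (small : EdgesAtMost r G) where

      -- By `isolated-count`, each (k + 1)-set A with exactly ℓ edges has at least k + 1 - rℓ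
      -- vertices u whose removal leaves ℓ edges. The double counting lists the same pairs as a
      -- k-set S together with a vertex counted by `staysExact S`.
      exactCount≤staysExact : ∀ k → (suc k ∸ r * ℓ) * exactCount (suc k) ≤ ∑ (kSubsets n k) staysExact
      exactCount≤staysExact k = begin
        (suc k ∸ r * ℓ) * exactCount (suc k)
          ≡⟨ cong ((suc k ∸ r * ℓ) *_) (length-filter exact? (kSubsets n (suc k))) ⟩
        (suc k ∸ r * ℓ) * ∑ (kSubsets n (suc k)) exact
          ≡⟨ ∑-*ˡ (kSubsets n (suc k)) (suc k ∸ r * ℓ) exact ⟨
        ∑ (kSubsets n (suc k)) (λ A → (suc k ∸ r * ℓ) * exact A)
          ≤⟨ ∑-kSubsets-mono n (suc k) pointwise ⟩
        ∑ (kSubsets n (suc k)) (λ A → ∑ (allFin n) (λ u → 𝟙 (u ∈? A) * (exact (remove A u) * exact A)))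
          ≡⟨ ∑-kSubsets-suc n k (λ S A → exact S * exact A) ⟨
        ∑ (kSubsets n k) (λ S → ∑ (allFin n) (λ u → 𝟙 (u ∉? S) * (exact S * exact (add S u))))
          ≡⟨ ∑-cong (kSubsets n k) (λ S → trans
               (∑-cong (allFin n) (λ u → e₁ (𝟙 (u ∉? S)) (exact S) (exact (add S u)))) (∑-*ˡ (allFin n) (exact S) _)) ⟩
        ∑ (kSubsets n k) staysExact ∎
        where
        e₁ : ∀ a b c → a * (b * c) ≡ b * (a * c)
        e₁ = solve-∀
        e₂ : ∀ a b c → a * b * c ≡ a * (b * c)
        e₂ = solve-∀
        pointwise : ∀ A → ∣ A ∣ ≡ suc k →
          (suc k ∸ r * ℓ) * exact A ≤ ∑ (allFin n) (λ u → 𝟙 (u ∈? A) * (exact (remove A u) * exact A))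
        pointwise A size = begin
          (suc k ∸ r * ℓ) * exact A      ≡⟨ *-comm _ (exact A) ⟩
          exact A * (suc k ∸ r * ℓ)
            ≤⟨ 𝟙-*-mono (exact? A) (λ p → ≤-trans (≤-reflexive (cong (_∸ r * ℓ) (sym size))) (isolated-count G r small ℓ A p)) ⟩
          exact A * ∑ (allFin n) (λ u → 𝟙 (u ∈? A) * exact (remove A u))
            ≡⟨ *-comm (exact A) _ ⟩
          ∑ (allFin n) (λ u → 𝟙 (u ∈? A) * exact (remove A u)) * exact A
            ≡⟨ ∑-*ʳ (allFin n) _ (exact A) ⟨
          ∑ (allFin n) (λ u → 𝟙 (u ∈? A) * exact (remove A u) * exact A)
            ≡⟨ ∑-cong (allFin n) (λ u → e₂ (𝟙 (u ∈? A)) (exact (remove A u)) (exact A)) ⟩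
          ∑ (allFin n) (λ u → 𝟙 (u ∈? A) * (exact (remove A u) * exact A)) ∎

      -- Multiplying by `k !` orders the k-sets into sequences, to which `extension-bound` applies
      -- from the empty set.
      exactCount-bound : ∀ k → 1 ≤ ℓ →
        k ! * ((suc k ∸ r * ℓ) * exactCount (suc k)) * suc k ^ suc k ≤ (n * k) ^ suc k
      exactCount-bound k 1≤ℓ = begin
        k ! * ((suc k ∸ r * ℓ) * exactCount (suc k)) * suc k ^ suc k
          ≤⟨ *-monoˡ-≤ (suc k ^ suc k) (*-monoʳ-≤ (k !) (exactCount≤staysExact k)) ⟩
        k ! * ∑ (kSubsets n k) staysExact * suc k ^ suc k
          ≡⟨ cong (_* suc k ^ suc k) (extendBy-⊥ k staysExact) ⟨
        extendBy k staysExact ⊥ * suc k ^ suc k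
          -- The weight is 0 because no prefix has been passed, and the empty set spans 0 < ℓ edges.
          ≤⟨ extension-bound k ⊥ 0 (subst (_< ℓ) (sym (edgesIn-⊥ G r small)) 1≤ℓ) ⟩
        (n * k + 0) ^ suc k
          ≡⟨ cong (_^ suc k) (+-identityʳ (n * k)) ⟩
        (n * k) ^ suc k ∎

      -- Inserts (1 - 1/k)^k ≤ 1/e with e replaced by its m-th partial sum s_m. For rℓ < k this
      -- reads: `exactCount k` is at most k / ((k - rℓ) s_m) times n^k / k!.
      exactCount-exp-bound : ∀ k m → 1 ≤ ℓ → .{{_ : NonZero k}} →
        expNumerator m * (k ∸ r * ℓ) * k ! * exactCount k ≤ m ! * k * n ^ k
      exactCount-exp-bound (suc k) m 1≤ℓ = *-cancelʳ-≤ _ _ s {{m^n≢0 (suc k) (suc k)}} (begin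
        N * d * (suc k * k !) * M * s            ≡⟨ e₁ N d (suc k) (k !) M s ⟩
        suc k * N * (k ! * (d * M) * s)          ≤⟨ *-monoʳ-≤ (suc k * N) (exactCount-bound k 1≤ℓ) ⟩
        suc k * N * (n * k) ^ suc k              ≡⟨ cong (suc k * N *_) (^-distribʳ-* n k (suc k)) ⟩
        suc k * N * (n ^ suc k * k ^ suc k)      ≡⟨ e₂ (suc k) N (n ^ suc k) (k ^ suc k) ⟩
        suc k * n ^ suc k * (N * k ^ suc k)      ≤⟨ *-monoʳ-≤ (suc k * n ^ suc k) (expNumerator-bound k m) ⟩
        suc k * n ^ suc k * (m ! * s)            ≡⟨ e₃ (suc k) (n ^ suc k) (m !) s ⟩
        m ! * suc k * n ^ suc k * s              ∎)
        where
        N = expNumerator m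
        d = suc k ∸ r * ℓ
        M = exactCount (suc k)
        s = suc k ^ suc k
        e₁ : ∀ N d k f M s → N * d * (k * f) * M * s ≡ k * N * (f * (d * M) * s)
        e₁ = solve-∀
        e₂ : ∀ k N a b → k * N * (a * b) ≡ k * a * (N * b)
        e₂ = solve-∀
        e₃ : ∀ k a f s → k * a * (f * s) ≡ f * k * a * s
        e₃ = solve-∀

      -- This is the bound for q = a / b. With X = `k * b * m !`, integrality turns the strict
      -- hypothesis into one with X + 1 on the left and ≤, and by `^-shift-≤` the extra one covers
      -- the passage from n^k to (n - k)^k.
      exactCount-ratio : ∀ k m a b .{{_ : NonZero k}} .{{_ : NonZero n}} → 1 ≤ ℓ → r * ℓ < k → k ≤ n →
        k * b * m ! < a * (k ∸ r * ℓ) * expNumerator m →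
        suc (k * b * m !) * (k * k) ≤ n →
        exactCount k * b ≤ a * length (kSubsets n k)
      exactCount-ratio k m a b 1≤ℓ rℓ<k k≤n above big = *-cancelʳ-≤ _ _ (N * d * k !) {{Ndk!≢0}} (begin
        M * b * (N * d * k !)               ≡⟨ e₁ M b (N * d * k !) ⟩
        b * (N * d * k ! * M)               ≤⟨ *-monoʳ-≤ b (exactCount-exp-bound k m 1≤ℓ) ⟩
        b * (m ! * k * n ^ k)               ≡⟨ e₂ b (m !) k (n ^ k) ⟩
        k * b * m ! * n ^ k                 ≤⟨ ^-shift-≤ (k * b * m !) k n k≤n big ⟩
        suc (k * b * m !) * (n ∸ k) ^ k     ≤⟨ *-mono-≤ above (kSubsets-count n k) ⟩
        a * d * N * (k ! * t)               ≡⟨ e₃ a d N (k !) t ⟩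
        a * t * (N * d * k !)               ∎)
        where
        M = exactCount k
        N = expNumerator m
        d = k ∸ r * ℓ
        t = length (kSubsets n k)
        expNumerator≢0 : ∀ m → NonZero (expNumerator m)
        expNumerator≢0 zero    = _
        expNumerator≢0 (suc m) = >-nonZero (m≤n+m 1 (suc m * expNumerator m))
        Ndk!≢0 : NonZero (N * d * k !)
        Ndk!≢0 = m*n≢0 (N * d) (k !) {{m*n≢0 N d {{expNumerator≢0 m}} {{>-nonZero (m<n⇒0<n∸m rℓ<k)}}}} {{k !≢0}}
        e₁ : ∀ M b z → M * b * z ≡ b * (z * M)
        e₁ = solve-∀
        e₂ : ∀ b f k p → b * (f * k * p) ≡ k * b * f * p
        e₂ = solve-∀
        e₃ : ∀ a d N f t → a * d * N * (f * t) ≡ a * t * (N * d * f)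
        e₃ = solve-∀

-- From natural numbers to rationals.

open import Data.Integer as ℤ using (ℤ; +_; -[1+_])
import Data.Integer.Properties as ℤ
open import Data.Integer.Tactic.RingSolver using () renaming (solve-∀ to ℤ-solve-∀)
open import Data.Nat using () renaming (_+_ to _+ℕ_)
open import Data.Rational using (ℚ; 0ℚ; mkℚ; toℚᵘ; ↥_; ↧ₙ_; _+_) renaming (_*_ to _*ℚ_; _<_ to _<ℚ_; _≤_ to _≤ℚ_)
import Data.Rational.Properties as ℚ
open import Data.Rational.Unnormalised as ℚᵘ using (mkℚᵘ; *≡*; *≤*)
import Data.Rational.Unnormalised.Properties as ℚᵘ

open Inequalities
open Counting

-- `frac` reduces to lowest terms, so comparisons are made in the unnormalised rationals, where they
-- are cross multiplications.
toℚᵘ-frac : ∀ a d → toℚᵘ (frac a (suc d)) ℚᵘ.≃ mkℚᵘ (+ a) d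
toℚᵘ-frac a d = ℚ.toℚᵘ-fromℚᵘ (mkℚᵘ (+ a) d)

-- With d = m! and s = m this is the recurrence of `expNumerator`.
frac-step : ∀ a s d .{{_ : NonZero d}} →
  frac a d + frac 1 (suc s * d) ≡ frac (suc s * a +ℕ 1) (suc s * d)
frac-step a s (suc d) = ℚ.toℚᵘ-injective (begin
  toℚᵘ (frac a (suc d) + frac 1 (suc s * suc d))            ≈⟨ ℚ.toℚᵘ-homo-+ (frac a (suc d)) (frac 1 (suc s * suc d)) ⟩
  toℚᵘ (frac a (suc d)) ℚᵘ.+ toℚᵘ (frac 1 (suc s * suc d))  ≈⟨ ℚᵘ.+-cong (toℚᵘ-frac a d) (toℚᵘ-frac 1 (d +ℕ s * suc d)) ⟩
  mkℚᵘ (+ a) d ℚᵘ.+ mkℚᵘ (+ 1) (d +ℕ s * suc d)     ≈⟨ *≡* cross ⟩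
  mkℚᵘ (+ (suc s * a +ℕ 1)) (d +ℕ s * suc d) ≈⟨ toℚᵘ-frac (suc s * a +ℕ 1) (d +ℕ s * suc d) ⟨
  toℚᵘ (frac (suc s * a +ℕ 1) (suc s * suc d))      ∎)
  where
  open ℚᵘ.≃-Reasoning
  identity : ∀ (a s d : ℤ) → (a ℤ.* (s ℤ.* d) ℤ.+ + 1 ℤ.* d) ℤ.* (s ℤ.* d) ≡ (s ℤ.* a ℤ.+ + 1) ℤ.* (d ℤ.* (s ℤ.* d))
  identity = ℤ-solve-∀
  cross : (+ a ℤ.* + (suc s * suc d) ℤ.+ + 1 ℤ.* + suc d) ℤ.* + (suc s * suc d) ≡
          + (suc s * a +ℕ 1) ℤ.* (+ suc d ℤ.* + (suc s * suc d))
  cross = trans (identity (+ a) (+ suc s) (+ suc d))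
    (cong (λ z → (z ℤ.+ + 1) ℤ.* (+ suc d ℤ.* + (suc s * suc d))) (sym (ℤ.pos-* (suc s) a)))

expPartial≡frac : ∀ m → expPartial m ≡ frac (expNumerator m) (m !)
expPartial≡frac zero    = refl
expPartial≡frac (suc m) = trans (cong (_+ frac 1 (suc m !)) (expPartial≡frac m))
  (frac-step (expNumerator m) m (m !) {{m !≢0}})

-- Clears the denominators in `AboveBound`, where N / d is a partial sum of e. The numerator of `q`
-- is a natural number because the left-hand side is non-negative.
above⇒ℕ : ∀ k c N d q .{{_ : NonZero d}} → frac k 1 <ℚ q *ℚ frac c 1 *ℚ frac N d →
  Σ[ a ∈ ℕ ] ((↥ q ≡ + a) × (k * ↧ₙ q * d < a * c * N))
above⇒ℕ k c N (suc d) q@(mkℚ num b _) h = nonNegative num refl (subst₂ ℤ._<_ left right (ℚᵘ.drop-*<* unnormalised))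
  where
  open ℚᵘ.≃-Reasoning
  product : toℚᵘ (q *ℚ frac c 1 *ℚ frac N (suc d)) ℚᵘ.≃ mkℚᵘ num b ℚᵘ.* mkℚᵘ (+ c) 0 ℚᵘ.* mkℚᵘ (+ N) d
  product = begin
    toℚᵘ (q *ℚ frac c 1 *ℚ frac N (suc d))              ≈⟨ ℚ.toℚᵘ-homo-* (q *ℚ frac c 1) (frac N (suc d)) ⟩
    toℚᵘ (q *ℚ frac c 1) ℚᵘ.* toℚᵘ (frac N (suc d))     ≈⟨ ℚᵘ.*-cong (ℚ.toℚᵘ-homo-* q (frac c 1)) (toℚᵘ-frac N d) ⟩
    mkℚᵘ num b ℚᵘ.* toℚᵘ (frac c 1) ℚᵘ.* mkℚᵘ (+ N) d   ≈⟨ ℚᵘ.*-congʳ {mkℚᵘ (+ N) d} (ℚᵘ.*-congˡ {mkℚᵘ num b} (toℚᵘ-frac c 0)) ⟩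
    mkℚᵘ num b ℚᵘ.* mkℚᵘ (+ c) 0 ℚᵘ.* mkℚᵘ (+ N) d      ∎
  unnormalised : mkℚᵘ (+ k) 0 ℚᵘ.< mkℚᵘ num b ℚᵘ.* mkℚᵘ (+ c) 0 ℚᵘ.* mkℚᵘ (+ N) d
  unnormalised = ℚᵘ.<-respʳ-≃ product (ℚᵘ.<-respˡ-≃ (toℚᵘ-frac k 0) (ℚ.toℚᵘ-mono-< h))
  left : + k ℤ.* ℚᵘ.↧ (mkℚᵘ num b ℚᵘ.* mkℚᵘ (+ c) 0 ℚᵘ.* mkℚᵘ (+ N) d) ≡ + (k * suc b * suc d)
  left = trans (sym (ℤ.pos-* k (suc b * 1 * suc d)))
    (cong +_ (trans (cong (λ z → k * (z * suc d)) (*-identityʳ (suc b))) (sym (*-assoc k (suc b) (suc d)))))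
  right : num ℤ.* + c ℤ.* + N ℤ.* + 1 ≡ num ℤ.* + (c * N)
  right = trans (ℤ.*-identityʳ _) (trans (ℤ.*-assoc num (+ c) (+ N)) (cong (num ℤ.*_) (sym (ℤ.pos-* c N))))
  nonNegative : ∀ z → num ≡ z → + (k * suc b * suc d) ℤ.< num ℤ.* + (c * N) →
    Σ[ a ∈ ℕ ] ((num ≡ + a) × (k * suc b * suc d < a * c * N))
  nonNegative (+ a)    refl lt = a , refl ,
    subst (k * suc b * suc d <_) (sym (*-assoc a c N)) (ℤ.drop‿+<+ (subst (_ ℤ.<_) (sym (ℤ.pos-* a (c * N))) lt))
  -- A negative numerator would make the right-hand side at most 0.
  nonNegative -[1+ a ] refl lt = ⊥-elim (ℤ.<⇒≱ lt (ℤ.≤-trans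
    (ℤ.*-monoʳ-≤-nonNeg (+ (c * N)) (ℤ.-≤+ {a} {0})) (ℤ.+≤+ z≤n)))

frac-suc≤ : ∀ M t q a → ↥ q ≡ + a → M * ↧ₙ q ≤ a * suc t → frac M (suc t) ≤ℚ q
frac-suc≤ M t (mkℚ _ b _) a refl h = ℚ.toℚᵘ-cancel-≤ (ℚᵘ.≤-respˡ-≃ (ℚᵘ.≃-sym (toℚᵘ-frac M t))
  (*≤* (subst₂ ℤ._≤_ (ℤ.pos-* M (suc b)) (ℤ.pos-* a (suc t)) (ℤ.+≤+ h))))

frac≤ : ∀ M t q a → ↥ q ≡ + a → M * ↧ₙ q ≤ a * t → frac M t ≤ℚ q
-- `frac M 0` is `0ℚ` by convention, which is also what `frac 0 1` computes to.
frac≤ M zero    q a eq h = frac-suc≤ 0 0 q a eq z≤n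
frac≤ M (suc t) q a eq h = frac-suc≤ M t q a eq h

-- The two inequalities between the limits.

theorem1p4 : (r k ℓ : ℕ) → 1 ≤ r → 1 ≤ k → 1 ≤ ℓ → r * ℓ < k →
    (a b : ℕ → ℚ) →
    ((n : ℕ) → k ≤ n → IsMaxUniform r n k ℓ (a n)) →
    ((n : ℕ) → k ≤ n → IsMaxAtMost r n k ℓ (b n)) →
    ((ε : ℚ) → 0ℚ <ℚ ε →
      ∃[ N ] ((n : ℕ) → N ≤ n → k ≤ n → a n ≤ℚ b n + ε))
    × ((q : ℚ) → AboveBound r k ℓ q →
      ∃[ N ] ((n : ℕ) → N ≤ n → k ≤ n → b n ≤ℚ q))
theorem1p4 r k ℓ 1≤r 1≤k 1≤ℓ rℓ<k a b maxA maxB = uniform≤atMost , atMost≤bound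
  where
  -- An r-uniform hypergraph attaining the first maximum is admissible for the second.
  a≤b : ∀ n → k ≤ n → a n ≤ℚ b n
  a≤b n k≤n with maxA n k≤n
  ... | (G , uniform , attained) , _ = subst (_≤ℚ b n) attained (proj₂ (maxB n k≤n) G
    (λ e e∈G → proj₁ (uniform e e∈G) , ≤-reflexive (proj₂ (uniform e e∈G))))

  uniform≤atMost : (ε : ℚ) → 0ℚ <ℚ ε → ∃[ N ] ((n : ℕ) → N ≤ n → k ≤ n → a n ≤ℚ b n + ε)
  -- The comparison holds at every n ≥ k, hence the threshold 0.
  uniform≤atMost ε 0<ε = 0 , λ n _ k≤n → ℚ.≤-trans (a≤b n k≤n)
    (subst (_≤ℚ b n + ε) (ℚ.+-identityʳ (b n)) (ℚ.+-monoʳ-≤ (b n) (ℚ.<⇒≤ 0<ε)))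

  atMost≤bound : (q : ℚ) → AboveBound r k ℓ q → ∃[ N ] ((n : ℕ) → N ≤ n → k ≤ n → b n ≤ℚ q)
  atMost≤bound q (m , above) with above⇒ℕ k (k ∸ r * ℓ) (expNumerator m) (m !) q {{m !≢0}}
    (subst (λ s → frac k 1 <ℚ q *ℚ frac (k ∸ r * ℓ) 1 *ℚ s) (expPartial≡frac m) above)
  -- The threshold is the one of `exactCount-ratio` for the fraction `p` over `↧ₙ q` and the `m`
  -- that witnesses `AboveBound`.
  ... | p , numerator , above-ℕ = suc (k * ↧ₙ q * m !) * (k * k) , bound
    where
    bound : (n : ℕ) → suc (k * ↧ₙ q * m !) * (k * k) ≤ n → k ≤ n → b n ≤ℚ q
    bound n N≤n k≤n with maxB n k≤n
    ... | (G , small , attained) , _ = subst (_≤ℚ q) attained (frac≤ (exactCount G ℓ k) (length (kSubsets n k)) q p numerator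
      (exactCount-ratio G ℓ r small k m p (↧ₙ q) {{>-nonZero 1≤k}} {{>-nonZero (≤-trans 1≤k k≤n)}}
        1≤ℓ rℓ<k k≤n above-ℕ N≤n))
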